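{- For every integer $\ell \ge 2$, $\tilde{r}(K_{1,3}, P_{\ell}) = \lfloor 3\ell/2 \rfloor$.
   Context: Given graphs $G$ and $H$, the $(G,H)$-online Ramsey game is played between two players, Builder and Painter, starting from an infinite set of isolated vertices. In each round Builder draws an edge between two nonadjacent vertices, and Painter immediately colors it red or blue. Builder's goal is to force either a red copy of $G$ or a blue copy of $H$ in as few rounds as possible; Painter's goal is to delay this as long as possible. The online Ramsey number $\tilde{r}(G,H)$ is the smallest number of rounds in which Builder can always guarantee a red copy of $G$ or a blue copy of $H$, assuming both players play optimally. $K_{1,3}$ denotes the star with three edges, and $P_\ell$ denotes the path with $\ell$ vertices. -}

module Defs where

open import Data.Nat using (ℕ; zero; suc; _<_)
open import Data.Fin using (Fin; toℕ) renaming (zero to fzero)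
open import Data.List using (List; _∷_; [])
open import Data.List.Membership.Propositional using (_∈_)
open import Data.Product using (Σ; ∃; _×_; _,_)
open import Data.Sum using (_⊎_)
open import Relation.Nullary using (¬_)
open import Relation.Binary.PropositionalEquality using (_≡_; _≢_)
open import Function.Definitions using (Injective)

record Graph : Set₁ where
  field
    size : ℕ
    Adj  : Fin size → Fin size → Set
open Graph public

K13 : Graph
K13 = record
  { size = 4
  ; Adj  = λ i j → (i ≡ fzero × j ≢ fzero) ⊎ (j ≡ fzero × i ≢ fzero) }

Path : ℕ → Graph
Path ℓ = record
  { size = ℓ
  ; Adj  = λ i j → (toℕ j ≡ suc (toℕ i)) ⊎ (toℕ i ≡ suc (toℕ j)) }

data Colour : Set where
  red blue : Colour

-- A board: the coloured edges drawn so far, on vertex set ℕ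
-- (the infinite supply of isolated vertices).
Board : Set
Board = List (ℕ × ℕ × Colour)

EdgeCol : Board → Colour → ℕ → ℕ → Set
EdgeCol S c u v = ((u , v , c) ∈ S) ⊎ ((v , u , c) ∈ S)

Adjacent : Board → ℕ → ℕ → Set
Adjacent S u v = ∃ λ c → EdgeCol S c u v

HasCopy : Board → Colour → Graph → Set
HasCopy S c G =
  Σ (Fin (size G) → ℕ) λ f →
    Injective _≡_ _≡_ f × (∀ i j → Adj G i j → EdgeCol S c (f i) (f j))

data BuilderWins (G H : Graph) : ℕ → Board → Set where
  done : ∀ {n S} → HasCopy S red G ⊎ HasCopy S blue H → BuilderWins G H n S
  step : ∀ {n S} (u v : ℕ) → u ≢ v → ¬ Adjacent S u v →
         (∀ c → BuilderWins G H n ((u , v , c) ∷ S)) →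
         BuilderWins G H (suc n) S

OnlineRamseyIs : Graph → Graph → ℕ → Set
OnlineRamseyIs G H n =
  BuilderWins G H n [] × (∀ m → m < n → ¬ BuilderWins G H m [])

{-# OPTIONS --safe #-}

-- Write h = ⌊ℓ/2⌋, so that ⌊3ℓ/2⌋ = (ℓ - 1) + (h + 1).
--
-- Painter answers red unless this creates a red vertex of degree 3, or closes a red cycle while
-- fewer than h edges are red; after h + 1 red edges she only answers blue.  If a blue P_ℓ
-- appeared with at most h red edges, the red graph would be a union of paths and (closing edges
-- aside) every edge of P_ℓ would have an end of red degree 2.  So the red degrees along P_ℓ sum
-- to at least 2h, which by the handshake lemma is also an upper bound.  This forces the degrees
-- along P_ℓ and leaves room for at most two vertices of red degree 1, joined by a closing edge;
-- but when h edges are red and Painter has answered a closing edge blue, there is a third one.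
--
-- Builder keeps a blue path and lets it grow at an end.  A red answer costs one of the h + 1 red
-- edges, but a vertex with two red edges forces all later edges at it to be blue, and such a
-- vertex between two others on the path repays one red edge.  A potential comparing the red
-- edges left with the vertices still missing never falls below what the final rounds need.
module Submission where

open import Defs
open import Data.Nat
open import Data.Nat.Properties
open import Data.Nat.DivMod using (m≡m%n+[m/n]*n; m%n<n; m≥n⇒m/n>0; +-distrib-/-∣ˡ; m*n/n≡m)
open import Data.Nat.Divisibility using (divides-refl)
open import Data.Nat.ListAction using (sum)
open import Algebra.Properties.CommutativeSemigroup +-commutativeSemigroup using (interchange)
open import Data.Fin using (Fin; toℕ; inject≤) renaming (zero to fzero; suc to fsuc)
open import Data.Fin.Properties using (toℕ-inject≤; inject≤-injective)
open import Data.List using (List; []; _∷_; _++_; _∷ʳ_; length; lookup; map; filter; reverse; tabulate)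
open import Data.List.Properties using (unfold-reverse; filter-notAll; length-tabulate; length-++)
open import Data.List.Membership.Propositional using (_∈_; lose)
open import Data.List.Membership.DecPropositional _≟_ using (_∈?_)
open import Data.List.Membership.Propositional.Properties using (∈-++⁺ˡ; ∈-++⁺ʳ; ∈-++⁻; ∈-∃++; ∈-lookup; ∈-filter⁺)
open import Data.List.Relation.Unary.Any as Any using (here; there)
open import Data.List.Relation.Unary.All as All using (All; []; _∷_)
import Data.List.Relation.Unary.All.Properties as All
open import Data.List.Relation.Unary.AllPairs using ([]; _∷_)
open import Data.List.Relation.Unary.Linked as Linked using (Linked; []; [-]; _∷_)
open import Data.List.Relation.Unary.Unique.Propositional using (Unique)
open import Data.List.Relation.Unary.Unique.Propositional.Properties using (tabulate⁺)
open import Data.List.Relation.Binary.Subset.Propositional using (_⊆_)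
open import Data.List.Relation.Binary.Permutation.Propositional using (_↭_; prep; swap; refl; ↭-refl; ↭-sym; ↭-trans) renaming (trans to compose)
open import Data.List.Relation.Binary.Permutation.Propositional.Properties using (All-resp-↭; shifts; ++⁺ˡ; ++⁺ʳ; ↭-reverse; ++-assoc)
open import Data.Product using (∃; ∃₂; _×_; _,_; proj₁; proj₂)
open import Data.Sum using (_⊎_; inj₁; inj₂; [_,_]′)
open import Data.Empty using (⊥)
open import Function using (_∘_; id)
open import Relation.Nullary using (¬_; Dec; yes; no; contradiction; ¬?; _×-dec_)
open import Relation.Binary.PropositionalEquality using (_≡_; _≢_; refl; sym; trans; cong; cong₂; subst; subst₂; ≢-sym)

private variable
  S S′ : Board
  N a b d e f g h j k l m n q t u v w x y z ℓ : ℕ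
  c : Colour
  xs ys A : List ℕ

-- Lists without repetition

Unique-resp-↭ : xs ↭ ys → Unique xs → Unique ys
Unique-resp-↭ refl         p                             = p
Unique-resp-↭ (prep _ σ)   (x∉ ∷ p)                      = All-resp-↭ σ x∉ ∷ Unique-resp-↭ σ p
Unique-resp-↭ (swap _ _ σ) ((x≢y ∷ x∉) ∷ (y∉ ∷ p)) =
  (≢-sym x≢y ∷ All-resp-↭ σ y∉) ∷ All-resp-↭ σ x∉ ∷ Unique-resp-↭ σ p
Unique-resp-↭ (compose σ τ)  p                             = Unique-resp-↭ τ (Unique-resp-↭ σ p)

lookup-injective : Unique xs → ∀ i j → lookup xs i ≡ lookup xs j → i ≡ j
lookup-injective (_  ∷ _) fzero    fzero    _  = refl
lookup-injective (x∉ ∷ _) fzero    (fsuc j) eq = contradiction eq (All.lookup x∉ (∈-lookup j))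
lookup-injective (x∉ ∷ _) (fsuc i) fzero    eq = contradiction (sym eq) (All.lookup x∉ (∈-lookup i))
lookup-injective (_  ∷ p) (fsuc i) (fsuc j) eq = cong fsuc (lookup-injective p i j eq)

-- Coloured edges and degrees

edge-sym : EdgeCol S c u v → EdgeCol S c v u
edge-sym (inj₁ e) = inj₂ e
edge-sym (inj₂ e) = inj₁ e

edge-mono : S ⊆ S′ → EdgeCol S c u v → EdgeCol S′ c u v
edge-mono σ (inj₁ e) = inj₁ (σ e)
edge-mono σ (inj₂ e) = inj₂ (σ e)

new-edge : EdgeCol ((u , v , c) ∷ S) c u v
new-edge = inj₁ (here refl)

Apart : Board → ℕ → ℕ → Set
Apart S u v = ¬ Adjacent S u v

apart-sym : Apart S u v → Apart S v u
apart-sym a (c , e) = a (c , edge-sym e)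

apart-∷ : Apart S u v → ¬ (u ≡ x × v ≡ y) → ¬ (v ≡ x × u ≡ y) → Apart ((x , y , c) ∷ S) u v
apart-∷ a ¬f ¬b (_ , inj₁ (here refl)) = ¬f (refl , refl)
apart-∷ a ¬f ¬b (_ , inj₁ (there e))   = a (_ , inj₁ e)
apart-∷ a ¬f ¬b (_ , inj₂ (here refl)) = ¬b (refl , refl)
apart-∷ a ¬f ¬b (_ , inj₂ (there e))   = a (_ , inj₂ e)

-- At least one, at least two red edges at u; more of them only help Builder.
Red1 Red2 : Board → ℕ → Set
Red1 S u = ∃ λ p → u ≢ p × EdgeCol S red u p
Red2 S u = ∃₂ λ p q → u ≢ p × u ≢ q × p ≢ q × EdgeCol S red u p × EdgeCol S red u q

red1-mono : S ⊆ S′ → Red1 S u → Red1 S′ u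
red1-mono σ (p , u≢p , e) = p , u≢p , edge-mono σ e

red2-mono : S ⊆ S′ → Red2 S u → Red2 S′ u
red2-mono σ (p , q , u≢p , u≢q , p≢q , e , f) = p , q , u≢p , u≢q , p≢q , edge-mono σ e , edge-mono σ f

red1-new : u ≢ v → Red1 ((u , v , red) ∷ S) u
red1-new u≢v = _ , u≢v , new-edge

red1-newʳ : u ≢ v → Red1 ((u , v , red) ∷ S) v
red1-newʳ u≢v = _ , ≢-sym u≢v , edge-sym new-edge

red2-new : u ≢ v → Apart S u v → Red1 S u → Red2 ((u , v , red) ∷ S) u
red2-new u≢v a (p , u≢p , e) =
  p , _ , u≢p , u≢v , (λ { refl → a (_ , e) }) , edge-mono there e , new-edge

red2-newʳ : u ≢ v → Apart S u v → Red1 S v → Red2 ((u , v , red) ∷ S) v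
red2-newʳ u≢v a (p , v≢p , e) =
  p , _ , v≢p , ≢-sym u≢v , (λ { refl → a (_ , edge-sym e) }) , edge-mono there e , edge-sym new-edge

-- The three leaves are distinct because `p` and `q` are already adjacent to `u`, whereas `v` is
-- not.
red-star : Red2 S u → u ≢ v → Apart S u v → HasCopy ((u , v , red) ∷ S) red K13
red-star {S} {u} {v} (p , q , u≢p , u≢q , p≢q , e , f) u≢v a = lookup vs , (λ {i} {j} → lookup-injective uniq i j) , star
  where
  vs : List ℕ
  vs = u ∷ p ∷ q ∷ v ∷ []
  p≢v : p ≢ v
  p≢v refl = a (_ , e)
  q≢v : q ≢ v
  q≢v refl = a (_ , f)
  uniq : Unique vs
  uniq = (u≢p ∷ u≢q ∷ u≢v ∷ []) ∷ (p≢q ∷ p≢v ∷ []) ∷ (q≢v ∷ []) ∷ [] ∷ []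
  leaf : ∀ j → j ≢ fzero → EdgeCol ((u , v , red) ∷ S) red u (lookup vs j)
  leaf fzero                   j≢ = contradiction refl j≢
  leaf (fsuc fzero)            _  = edge-mono there e
  leaf (fsuc (fsuc fzero))     _  = edge-mono there f
  leaf (fsuc (fsuc (fsuc fzero))) _ = new-edge
  star : ∀ i j → Adj K13 i j → EdgeCol ((u , v , red) ∷ S) red (lookup vs i) (lookup vs j)
  star i j (inj₁ (refl , j≢)) = leaf j j≢
  star i j (inj₂ (refl , i≢)) = edge-sym (leaf i i≢)

-- Blue paths

-- The list holds the vertices in order. Repetitions are excluded later, for all paths of a forest
-- at once.
data BPath (S : Board) : ℕ → ℕ → ℕ → List ℕ → Set where
  [_]    : ∀ v → BPath S v v 1 (v ∷ [])
  _∷⟨_⟩_ : ∀ u → EdgeCol S blue u w → BPath S w v k xs → BPath S u v (suc k) (u ∷ xs)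

path-mono : S ⊆ S′ → BPath S u v k xs → BPath S′ u v k xs
path-mono σ [ v ]          = [ v ]
path-mono σ (u ∷⟨ e ⟩ P) = u ∷⟨ edge-mono σ e ⟩ path-mono σ P

path-++ : BPath S u v k xs → EdgeCol S blue v w → BPath S w x l ys → BPath S u x (k + l) (xs ++ ys)
path-++ [ v ]          f Q = v ∷⟨ f ⟩ Q
path-++ (u ∷⟨ e ⟩ P) f Q = u ∷⟨ e ⟩ path-++ P f Q

path-reverse : BPath S u v k xs → BPath S v u k (reverse xs)
path-reverse [ v ] = [ v ]
path-reverse {S = S} {v = v} {k = suc k} {xs = u ∷ xs} (u ∷⟨ e ⟩ P)
  rewrite unfold-reverse u xs =
  subst (λ k → BPath S v u k (reverse xs ∷ʳ u)) (+-comm k 1) (path-++ (path-reverse P) (edge-sym e) [ u ])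

first∈ : BPath S u v k xs → u ∈ xs
first∈ [ v ]          = here refl
first∈ (u ∷⟨ e ⟩ P) = here refl

last∈ : BPath S u v k xs → v ∈ xs
last∈ [ v ]          = here refl
last∈ (u ∷⟨ e ⟩ P) = there (last∈ P)

path-length : BPath S u v k xs → k ≡ length xs
path-length [ v ]          = refl
path-length (u ∷⟨ e ⟩ P) = cong suc (path-length P)

path-edge : BPath S u v k xs → ∀ i j → toℕ j ≡ suc (toℕ i) → EdgeCol S blue (lookup xs i) (lookup xs j)
path-edge [ v ] fzero fzero ()
path-edge (u ∷⟨ e ⟩ [ v ])        fzero    (fsuc fzero) _  = e
path-edge (u ∷⟨ e ⟩ (v ∷⟨ _ ⟩ P)) fzero    (fsuc fzero) _  = e
path-edge (u ∷⟨ e ⟩ P)              (fsuc i) (fsuc j)     eq = path-edge P i j (suc-injective eq)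

-- The first `ℓ` vertices of the path form the copy, so Builder may overshoot.
path-copy : ∀ {ℓ} → BPath S u v k xs → Unique xs → ℓ ≤ k → HasCopy S blue (Path ℓ)
path-copy {S} {xs = xs} {ℓ = ℓ} P uniq ℓ≤k = (λ i → lookup xs (inject≤ i ℓ≤)) , inj , adj
  where
  ℓ≤ : ℓ ≤ length xs
  ℓ≤ = ≤-trans ℓ≤k (≤-reflexive (path-length P))
  inj : ∀ {i j} → lookup xs (inject≤ i ℓ≤) ≡ lookup xs (inject≤ j ℓ≤) → i ≡ j
  inj eq = inject≤-injective ℓ≤ ℓ≤ _ _ (lookup-injective uniq _ _ eq)
  consecutive : ∀ i j → toℕ j ≡ suc (toℕ i) → EdgeCol S blue (lookup xs (inject≤ i ℓ≤)) (lookup xs (inject≤ j ℓ≤))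
  consecutive i j eq = path-edge P _ _ (trans (toℕ-inject≤ j ℓ≤) (trans eq (cong suc (sym (toℕ-inject≤ i ℓ≤)))))
  adj : ∀ i j → Adj (Path ℓ) i j → EdgeCol S blue (lookup xs (inject≤ i ℓ≤)) (lookup xs (inject≤ j ℓ≤))
  adj i j (inj₁ eq) = consecutive i j eq
  adj i j (inj₂ eq) = edge-sym (consecutive j i eq)

-- Linear forests of blue paths

-- A path is recorded by its two ends and its number of vertices.
Seg : Set
Seg = ℕ × ℕ × ℕ

private variable
  s₁ s₂ s₃ s₄ : Seg
  ss ts : List Seg

data Cover (S : Board) : List Seg → List ℕ → Set where
  []  : Cover S [] []
  _∷_ : BPath S u v k xs → Cover S ss ys → Cover S ((u , v , k) ∷ ss) (xs ++ ys)

Below : ℕ → Board → Set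
Below N S = ∀ {u v c} → (u , v , c) ∈ S → u < N × v < N

-- The vertices from N on are unused.
record Forest (S : Board) (N : ℕ) (ss : List Seg) : Set where
  field
    {verts} : List ℕ
    cover   : Cover S ss verts
    unique  : Unique verts
    below   : All (_< N) verts
    bounded : Below N S
open Forest

cover-mono : S ⊆ S′ → Cover S ss xs → Cover S′ ss xs
cover-mono σ []      = []
cover-mono σ (P ∷ C) = path-mono σ P ∷ cover-mono σ C

cover-perm : ss ↭ ts → Cover S ss xs → ∃ λ ys → xs ↭ ys × Cover S ts ys
cover-perm refl         C       = _ , ↭-refl , C
cover-perm (prep _ σ)   (P ∷ C) with cover-perm σ C
... | _ , τ , D = _ , ++⁺ˡ _ τ , P ∷ D
cover-perm (swap _ _ σ) (_∷_ {xs = xs} P (_∷_ {xs = ys} Q C)) with cover-perm σ C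
... | _ , τ , D = _ , ↭-trans (shifts xs ys) (++⁺ˡ ys (++⁺ˡ xs τ)) , Q ∷ P ∷ D
cover-perm (compose σ τ)  C with cover-perm σ C
... | _ , σ′ , D with cover-perm τ D
... | _ , τ′ , E = _ , ↭-trans σ′ τ′ , E

reindex : xs ↭ ys → Unique xs → All (_< N) xs → Below N S → Cover S ss ys → Forest S N ss
reindex σ uniq bel bnd C = record
  { cover = C ; unique = Unique-resp-↭ σ uniq ; below = All-resp-↭ σ bel ; bounded = bnd }

perm : ss ↭ ts → Forest S N ss → Forest S N ts
perm σ F with cover-perm σ (cover F)
... | _ , τ , D = reindex τ (unique F) (below F) (bounded F) D

swap₂ : Forest S N (s₁ ∷ s₂ ∷ ss) → Forest S N (s₂ ∷ s₁ ∷ ss)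
swap₂ = perm (swap _ _ ↭-refl)

flip₁ : Forest S N ((u , v , k) ∷ ss) → Forest S N ((v , u , k) ∷ ss)
flip₁ record { cover = _∷_ {xs = xs} P C ; unique = uniq ; below = bel ; bounded = bnd } =
  reindex (++⁺ʳ _ (↭-sym (↭-reverse xs))) uniq bel bnd (path-reverse P ∷ C)

join : EdgeCol S blue v w → Forest S N ((u , v , k) ∷ (w , x , l) ∷ ss) → Forest S N ((u , x , k + l) ∷ ss)
join e record { cover = _∷_ {xs = xs} P (_∷_ {xs = ys} {ys = zs} Q C) ; unique = uniq ; below = bel ; bounded = bnd } =
  reindex (↭-sym (++-assoc xs ys zs)) uniq bel bnd (path-++ P e Q ∷ C)

first<N : Forest S N ((u , v , k) ∷ ss) → u < N
first<N record { cover = P ∷ C ; below = bel } = All.lookup bel (∈-++⁺ˡ (first∈ P))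

last<N : Forest S N ((u , v , k) ∷ ss) → v < N
last<N F = first<N (flip₁ F)

first≢first : Forest S N ((u , v , k) ∷ (w , x , l) ∷ ss) → u ≢ w
first≢first record { cover = P ∷ (Q ∷ C) ; unique = uniq } = go P (first∈ Q) uniq
  where
  go : BPath S u v k xs → w ∈ ys → Unique (xs ++ ys ++ _) → u ≢ w
  go [ v ]          w∈ (v∉ ∷ _) = All.lookup v∉ (∈-++⁺ˡ w∈)
  go (_∷⟨_⟩_ {xs = xs} u e P) w∈ (u∉ ∷ _) = All.lookup u∉ (∈-++⁺ʳ xs (∈-++⁺ˡ w∈))

first≢last : Forest S N ((u , v , k) ∷ (w , x , l) ∷ ss) → u ≢ x
first≢last F = first≢first (swap₂ (flip₁ (swap₂ F)))

last≢first : Forest S N ((u , v , k) ∷ (w , x , l) ∷ ss) → v ≢ w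
last≢first F = first≢first (flip₁ F)

fresh-apart : Below N S → Apart S u N
fresh-apart bnd (_ , inj₁ e) = <-irrefl refl (proj₂ (bnd e))
fresh-apart bnd (_ , inj₂ e) = <-irrefl refl (proj₁ (bnd e))

add-old : u < N → v < N → Forest S N ss → Forest ((u , v , c) ∷ S) N ss
add-old u<N v<N F = record { cover = cover-mono there (cover F) ; unique = unique F ; below = below F
  ; bounded = λ { (here refl) → u<N , v<N ; (there e) → bounded F e } }

add-new : u < N → Forest S N ss → Forest ((u , N , c) ∷ S) (suc N) ((N , N , 1) ∷ ss)
add-new {N = N} u<N F = record
  { cover   = [ N ] ∷ cover-mono there (cover F)
  ; unique  = All.map (λ v<N N≡v → <-irrefl (sym N≡v) v<N) (below F) ∷ unique F
  ; below   = ≤-refl ∷ All.map m<n⇒m<1+n (below F)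
  ; bounded = λ { (here refl) → m<n⇒m<1+n u<N , ≤-refl
                ; (there e) → m<n⇒m<1+n (proj₁ (bounded F e)) , m<n⇒m<1+n (proj₂ (bounded F e)) } }

Unique-++⁻ˡ : ∀ xs → Unique (xs ++ ys) → Unique xs
Unique-++⁻ˡ []       _        = []
Unique-++⁻ˡ (x ∷ xs) (x∉ ∷ p) = All.++⁻ˡ xs x∉ ∷ Unique-++⁻ˡ xs p

apart-new : u < N → v < N → Apart S u v → Apart ((x , N , c) ∷ S) u v
apart-new u<N v<N ap = apart-∷ ap (λ { (_ , refl) → <-irrefl refl v<N }) (λ { (_ , refl) → <-irrefl refl u<N })

apart-fresh : Below N S → v < N → v ≢ x → Apart ((x , N , c) ∷ S) N v
apart-fresh bnd v<N v≢x =
  apart-∷ (apart-sym (fresh-apart bnd)) (λ { (_ , refl) → <-irrefl refl v<N }) (λ { (v≡x , _) → v≢x v≡x })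

second<N : Forest S N (s₁ ∷ (u , v , k) ∷ ss) → u < N
second<N F = first<N (swap₂ F)

rot₃ : Forest S N (s₁ ∷ s₂ ∷ s₃ ∷ ss) → Forest S N (s₃ ∷ s₁ ∷ s₂ ∷ ss)
rot₃ F = swap₂ (perm (prep _ (swap _ _ refl)) F)

swap₂₃ : Forest S N (s₁ ∷ s₂ ∷ s₃ ∷ ss) → Forest S N (s₁ ∷ s₃ ∷ s₂ ∷ ss)
swap₂₃ = perm (prep _ (swap _ _ refl))

resize : k ≡ l → Forest S N ((u , v , k) ∷ ss) → Forest S N ((u , v , l) ∷ ss)
resize refl F = F

apart-off : Apart S u v → u ≢ x → v ≢ x → Apart ((x , y , c) ∷ S) u v
apart-off ap u≢x v≢x = apart-∷ ap (u≢x ∘ proj₁) (v≢x ∘ proj₁)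

apart-offʳ : Apart S u v → u ≢ y → v ≢ y → Apart ((x , y , c) ∷ S) u v
apart-offʳ ap u≢y v≢y = apart-∷ ap (v≢y ∘ proj₂) (u≢y ∘ proj₂)

rot₄ : Forest S N (s₁ ∷ s₂ ∷ s₃ ∷ s₄ ∷ ss) → Forest S N (s₄ ∷ s₁ ∷ s₂ ∷ s₃ ∷ ss)
rot₄ F = rot₃ (perm (prep _ (prep _ (swap _ _ refl))) F)

ends≢ : Forest S N ((u , v , suc (suc k)) ∷ ss) → u ≢ v
ends≢ record { cover = (u ∷⟨ _ ⟩ P) ∷ _ ; unique = u∉ ∷ _ } = All.lookup u∉ (∈-++⁺ˡ (last∈ P))

-- Builder's moves and final rounds

module Builder (ℓ : ℕ) where

  BW : ℕ → Board → Set
  BW = BuilderWins K13 (Path ℓ)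

  win : Forest S N ((u , v , k) ∷ ss) → ℓ ≤ k → BW n S
  win record { cover = P ∷ C ; unique = uniq } ℓ≤k = done (inj₂ (path-copy P (Unique-++⁻ˡ _ uniq) ℓ≤k))

  draw : u ≢ v → Apart S u v → BW n ((u , v , red) ∷ S) → BW n ((u , v , blue) ∷ S) → BW (suc n) S
  draw u≢v ap r b = step _ _ u≢v ap λ { red → r ; blue → b }

  -- A red answer would complete a star at `u`, so only the blue answer has to be played on.
  forced : Red2 S u → u ≢ v → Apart S u v → BW n ((u , v , blue) ∷ S) → BW (suc n) S
  forced r2 u≢v ap = draw u≢v ap (done (inj₁ (red-star r2 u≢v ap)))

  extend : Forest S N ((u , v , k) ∷ ss) →
           (Forest ((u , N , red) ∷ S) (suc N) ((N , N , 1) ∷ (u , v , k) ∷ ss) → BW n ((u , N , red) ∷ S)) →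
           (Forest ((u , N , blue) ∷ S) (suc N) ((N , v , suc k) ∷ ss) → BW n ((u , N , blue) ∷ S)) →
           BW (suc n) S
  extend F r b = draw (<⇒≢ (first<N F)) (fresh-apart (bounded F)) (r (add-new (first<N F) F))
    (b (join (edge-sym new-edge) (add-new (first<N F) F)))

  extend! : Forest S N ((u , v , k) ∷ ss) → Red2 S u →
            (Forest ((u , N , blue) ∷ S) (suc N) ((N , v , suc k) ∷ ss) → BW n ((u , N , blue) ∷ S)) →
            BW (suc n) S
  extend! F r2 b = forced r2 (<⇒≢ (first<N F)) (fresh-apart (bounded F))
    (b (join (edge-sym new-edge) (add-new (first<N F) F)))

  -- The edge joins the first recorded ends of the first two paths; flips and rotations of the
  -- forest bring the intended ends into that place.
  connect : Forest S N ((u , v , k) ∷ (w , x , l) ∷ ss) → Apart S u w →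
            (Forest ((u , w , red) ∷ S) N ((u , v , k) ∷ (w , x , l) ∷ ss) → BW n ((u , w , red) ∷ S)) →
            (Forest ((u , w , blue) ∷ S) N ((v , x , k + l) ∷ ss) → BW n ((u , w , blue) ∷ S)) →
            BW (suc n) S
  connect F ap r b = draw (first≢first F) ap (r (add-old (first<N F) (second<N F) F))
    (b (join new-edge (flip₁ (add-old (first<N F) (second<N F) F))))

  connect! : Forest S N ((u , v , k) ∷ (w , x , l) ∷ ss) → Apart S u w → Red2 S u →
             (Forest ((u , w , blue) ∷ S) N ((v , x , k + l) ∷ ss) → BW n ((u , w , blue) ∷ S)) →
             BW (suc n) S
  connect! F ap r2 b = forced r2 (first≢first F) ap
    (b (join new-edge (flip₁ (add-old (first<N F) (second<N F) F))))

  connectʳ! : Forest S N ((u , v , k) ∷ (w , x , l) ∷ ss) → Apart S u w → Red2 S w →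
              (Forest ((w , u , blue) ∷ S) N ((v , x , k + l) ∷ ss) → BW n ((w , u , blue) ∷ S)) →
              BW (suc n) S
  connectʳ! F ap r2 b = forced r2 (≢-sym (first≢first F)) (apart-sym ap)
    (b (join (edge-sym new-edge) (flip₁ (add-old (second<N F) (first<N F) F))))

  -- An optional second blue path, waiting to be absorbed by the main one: it starts at a vertex
  -- of red degree 2 and its last vertex may still be joined to the vertices in A.  The indices
  -- are its number of vertices and the number of edges that joining it costs.
  data Spare (S : Board) (A : List ℕ) : List Seg → ℕ → ℕ → Set where
    none : Spare S A ss 0 0
    some : Red2 S z → All (Apart S y) A → Spare S A ((z , y , q) ∷ ss) q 1

  -- The edge from `y` to `e` is forced at `e`. The new end is `z`, which again has two red edges,
  -- so the main path keeps a forcing end.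
  absorb : Forest S N ((e , w , k) ∷ s₁ ∷ ss) → Red2 S e → Spare S (e ∷ A) ss q d →
           (∀ {S′ e′ ss′} → S ⊆ S′ → Forest S′ N ((e′ , w , q + k) ∷ s₁ ∷ ss′) → Red2 S′ e′ → BW n S′) →
           BW (d + n) S
  absorb F r2 none                  cont = cont id F r2
  absorb F r2 (some r2z (ap ∷ _)) cont =
    connectʳ! (flip₁ (rot₃ F)) ap r2 λ F′ → cont there F′ (red2-mono there r2z)

  -- A red answer gives `e` its second red edge, and `e` absorbs the spare path. A blue answer adds
  -- a vertex, to which the forcing end `z` of the spare path is joined. Either way the spare path
  -- costs `d` rounds.
  push : Forest S N ((e , w , k) ∷ ss) → Red1 S e → Spare S (e ∷ A) ss q d →
         (∀ {S′ N′ e′ y ss′} → Forest S′ N′ ((e′ , w , q + k) ∷ (y , y , 1) ∷ ss′) → Red2 S′ e′ → Red1 S′ y → BW n S′) →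
         (∀ {S′ N′ b ss′} → Forest S′ N′ ((b , w , suc (q + k)) ∷ ss′) → BW n S′) →
         BW (d + suc n) S
  push {S = S} {N = N} {e = e} {w = w} {k = k} {ss = ss} {q = q} {d = d} {n = n} F r1 sp r b =
    subst (λ m → BW m S) (sym (+-suc d n)) (extend F red-case (blue-case sp F))
    where
    e≢N : e ≢ N
    e≢N = <⇒≢ (first<N F)
    spare-new : Spare S (e ∷ _) ss q d → Forest S N ((e , w , k) ∷ ss) → Spare ((e , N , red) ∷ S) (e ∷ []) ss q d
    spare-new none                  F = none
    spare-new (some r2z (ap ∷ _)) F =
      some (red2-mono there r2z) (apart-new (last<N (swap₂ F)) (first<N F) ap ∷ [])
    red-case : Forest ((e , N , red) ∷ S) (suc N) ((N , N , 1) ∷ (e , w , k) ∷ ss) → BW (d + n) ((e , N , red) ∷ S)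
    red-case F′ = absorb (swap₂ F′) (red2-new e≢N (fresh-apart (bounded F)) r1) (spare-new sp F)
      λ σ F″ r2 → r F″ r2 (red1-mono σ (red1-newʳ e≢N))
    blue-case : Spare S (e ∷ _) ss q d → Forest S N ((e , w , k) ∷ ss) →
               Forest ((e , N , blue) ∷ S) (suc N) ((N , w , suc k) ∷ ss) → BW (d + n) ((e , N , blue) ∷ S)
    blue-case none           F F′ = b F′
    blue-case (some r2z _) F F′ =
      connect! (swap₂ F′) (apart-sym (apart-fresh (bounded F) (second<N F) (≢-sym (first≢first F)))) (red2-mono there r2z)
        λ F″ → b (resize (+-suc q k) F″)

  finish₁ : Forest S N ((e , w , k) ∷ ss) → Red1 S e → Spare S (e ∷ A) ss q d → ℓ ≤ suc (q + k) → BW (d + suc (suc n)) S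
  finish₁ F r1 sp le = push F r1 sp (λ F′ r2 _ → extend! F′ r2 λ F″ → win F″ le) (λ F′ → win F′ le)

  finish-fresh : Forest S N ((b , w , k) ∷ ss) → ℓ ≤ suc k → BW (3 + n) S
  finish-fresh {b = b} F le = extend F
    (λ F′ → finish₁ {A = []} (swap₂ F′) (red1-new (<⇒≢ (first<N F))) none le) (λ F′ → win F′ le)

  -- If the edge at `y` is red, both `e` and `y` are forcing and a fresh vertex joins them. If it is
  -- blue, `y` and its new neighbour are attached to `e` together.
  finish-red2 : Forest S N ((e , w , k) ∷ (y , y , 1) ∷ ss) → Red2 S e → Red1 S y → ℓ ≤ 2 + k → BW (3 + n) S
  finish-red2 {e = e} {y = y} F r2 r1 le = extend (swap₂ F)
    (λ F′ → extend! (rot₃ F′) (red2-mono there r2) λ F″ →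
      connect! (swap₂ (swap₂₃ F″))
        (apart-sym (apart-fresh (bounded F′) (m<n⇒m<1+n y<N) (≢-sym (first≢first F))))
        (red2-mono there (red2-new (<⇒≢ y<N) (fresh-apart (bounded F)) r1)) λ F₃ → win F₃ le)
    (λ F′ → connectʳ! F′ (apart-fresh (bounded F) (first<N F) (first≢first F)) (red2-mono there r2) λ F″ → win F″ le)
    where y<N = second<N F

  finish₂ : Forest S N ((e , w , k) ∷ ss) → Red1 S e → Spare S (e ∷ A) ss q d → ℓ ≤ 2 + (q + k) → BW (d + (4 + n)) S
  finish₂ F r1 sp le = push F r1 sp (λ F′ r2 r1′ → finish-red2 F′ r2 r1′ le) (λ F′ → finish-fresh F′ le)

  idle : BW n S → BW (suc n) S
  idle (done x)          = done x
  idle (step u v p q r) = step u v p q (idle ∘ r)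

  cast : m ≡ n → BW m S → BW n S
  cast refl b = b

  shift : ∀ t k → ℓ ≤ suc t + k → ℓ ≤ t + suc k
  shift t k = subst (ℓ ≤_) (sym (+-suc t k))

  -- A fresh vertex is joined to `e` and to `f` by two forced edges: the paths are linked and one
  -- vertex is gained.
  hop : Forest S N ((e , w , k) ∷ (f , x , l) ∷ ss) → Red2 S e → Red2 S f →
        (∀ {S′ N′} → S ⊆ S′ → Forest S′ N′ ((x , w , l + suc k) ∷ ss) → BW n S′) → BW (2 + n) S
  hop F r2e r2f cont = extend! F r2e λ F′ →
    connect! (swap₂ F′) (apart-sym (apart-fresh (bounded F) (second<N F) (≢-sym (first≢first F)))) (red2-mono there r2f)
      λ F″ → cont (there ∘ there) F″

  -- A red answer at `b` prepares a `hop`. After a blue one the fresh vertex is already attached to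
  -- `b` and is joined to `f`; this reaches the same length one round earlier.
  detour : Forest S N ((b , w , k) ∷ (f , x , l) ∷ ss) → Red1 S b → Red2 S f →
           (∀ {S′ N′ ss′} → S ⊆ S′ → Forest S′ N′ ((x , w , l + suc k) ∷ ss′) → BW n S′) → BW (3 + n) S
  detour F r1 r2 cont = extend F
    (λ F′ → hop (rot₃ (rot₃ F′)) (red2-new (<⇒≢ (first<N F)) (fresh-apart (bounded F)) r1) (red2-mono there r2)
      λ σ → cont (σ ∘ there))
    (λ F′ → connect! (swap₂ F′) (apart-sym (apart-fresh (bounded F) (second<N F) (≢-sym (first≢first F)))) (red2-mono there r2)
      λ F″ → idle (cont (there ∘ there) F″))

  spare-past : Spare S A ss q d → Forest S N (s₁ ∷ s₂ ∷ ss) → ∃ λ ts → Forest S N (s₁ ∷ ts) × Spare S A ts q d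
  spare-past none          F = _ , F , none
  spare-past (some r2 ap) F = _ , swap₂₃ F , some r2 ap

  spare-link : Forest S N ((e , w , k) ∷ (f , f , 1) ∷ ss) → Spare S (e ∷ f ∷ []) ss q d →
               Spare ((f , e , c) ∷ S) (f ∷ e ∷ []) ss q d
  spare-link F none = none
  spare-link F (some r2 (ye ∷ yf ∷ [])) = some (red2-mono there r2)
    (apart-offʳ yf y≢e (first≢first (swap₂ F)) ∷ apart-off ye y≢f (first≢first F) ∷ [])
    where
    y≢e = last≢first (rot₃ F)
    y≢f = last≢first (swap₂₃ (rot₃ F))

  spend : ∀ t c → BW (suc (t + c)) S → BW (t + suc c) S
  spend t c = cast (sym (+-suc t c))

  spend₂ : ∀ t c → BW (2 + (t + c)) S → BW (t + (2 + c)) S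
  spend₂ t c = cast (sym (trans (+-suc t (suc c)) (cong suc (+-suc t c))))

  unspend : ∀ t c → BW (t + suc c) S → BW (suc (t + c)) S
  unspend t c = cast (+-suc t c)

  unspend₂ : ∀ t c → BW (t + (2 + c)) S → BW (2 + (t + c)) S
  unspend₂ t c = cast (trans (+-suc t (suc c)) (cong suc (+-suc t c)))

  spare-swap : Spare S (u ∷ v ∷ []) ss q d → Spare S (v ∷ u ∷ []) ss q d
  spare-swap none                       = none
  spare-swap (some r2 (yu ∷ yv ∷ [])) = some r2 (yv ∷ yu ∷ [])

  -- The states of Builder's strategy.  If m vertices are still missing and c red edges are left,
  -- then m + c rounds remain, up to edges already drawn (a pendant edge) or still needed to join
  -- two paths.  Here m is suc t, suc t, 2 + t, 3 + t, suc t and suc t, in this order.  The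
  -- hypothesis on c * 2 is the potential: 2c - m is at least 4, 0, 1, 1, 4 and 4,
  -- where in TwoPathsRed the red edge drawn last is still counted in c.
  FreshEnd RedEnds RedOutside PendantOutside TwoPaths TwoPathsRed : ℕ → ℕ → Set
  FreshEnd t c = ∀ {S N b w k ss} → Forest S N ((b , w , k) ∷ ss) →
    5 + t ≤ c * 2 → ℓ ≤ suc t + k → BW (suc t + c) S
  RedEnds t c = ∀ {S N e f w k q d ss} → Forest S N ((e , w , k) ∷ (f , f , 1) ∷ ss) →
    Red1 S e → Red1 S f → Apart S e f → Spare S (e ∷ f ∷ []) ss q d →
    suc t ≤ c * 2 → ℓ ≤ suc t + (q + k) → BW (d + (suc t + c)) S
  RedOutside t c = ∀ {S N b f w k ss} → Forest S N ((b , w , k) ∷ (f , f , 1) ∷ ss) →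
    Red1 S f → Apart S f b → 3 + t ≤ c * 2 → ℓ ≤ 2 + t + k → BW (2 + t + c) S
  PendantOutside t c = ∀ {S N b f g w k ss} → Forest S N ((b , w , k) ∷ (g , f , 2) ∷ ss) →
    Red1 S f → Apart S f b → Apart S g b → 4 + t ≤ c * 2 → ℓ ≤ 3 + t + k → BW (2 + t + c) S
  TwoPaths t c = ∀ {S N h g j w k q ss} → Forest S N ((h , w , k) ∷ (g , j , 2 + q) ∷ ss) →
    Apart S g h → Apart S j h → 5 + t ≤ c * 2 → ℓ ≤ suc t + (2 + q + k) → BW (2 + t + c) S
  TwoPathsRed t c = ∀ {S N h g j w k q ss} → Forest S N ((g , j , 2 + q) ∷ (h , w , k) ∷ ss) →
    Red1 S h → Red1 S g → Apart S j h → 5 + t ≤ c * 2 → ℓ ≤ suc t + (2 + q + k) → BW (suc t + c) S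

  -- Builder's strategy by recursion on the missing vertices

  fresh-end       : ∀ t c → FreshEnd t c
  red-ends        : ∀ t c → RedEnds t c
  red-outside     : ∀ t c → RedOutside t c
  pendant-outside : ∀ t c → PendantOutside t c
  two-paths       : ∀ t c → TwoPaths t c
  two-paths-red   : ∀ t c → TwoPathsRed t c

  fresh-end zero          (suc (suc c))       F H le = finish-fresh F le
  fresh-end zero          (suc zero)          F (s≤s (s≤s ())) le
  fresh-end (suc zero)    (suc (suc (suc c))) F H le = extend F
    (λ F′ → extend (swap₂ F′)
      (λ F″ → finish-red2 (swap₂ F″)
        (red2-new (<⇒≢ (second<N F′)) (fresh-apart (bounded F′)) (red1-new (<⇒≢ (first<N F))))
        (red1-newʳ (<⇒≢ (second<N F′))) le)
      (λ F″ → finish-fresh F″ le))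
    (λ F′ → finish-fresh F′ le)
  fresh-end (suc zero)    (suc zero)          F (s≤s (s≤s ())) le
  fresh-end (suc zero)    (suc (suc zero))    F (s≤s (s≤s (s≤s (s≤s ())))) le
  fresh-end (suc (suc t)) (suc zero)          F (s≤s (s≤s ())) le
  -- A blue answer at `b` just lengthens the path. After a red one `b` is tried again: a second red
  -- answer makes the next edge at `b` forced, and in both cases a vertex with a red edge remains
  -- outside the path.
  fresh-end (suc (suc t)) (suc (suc c))       {k = k} F H@(s≤s (s≤s (s≤s (s≤s p)))) le = spend₂ (3 + t) c (extend F
    (λ F′ → let b≢N = <⇒≢ (first<N F) ; ap = fresh-apart (bounded F′) in extend (swap₂ F′)
      (λ F″ → extend! (swap₂ F″)
         (red2-new (<⇒≢ (second<N F′)) ap (red1-new b≢N))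
         λ F₃ → red-outside t c F₃ (red1-mono there (red1-newʳ (<⇒≢ (second<N F′))))
           (apart-sym (apart-fresh (bounded F″) ≤-refl (≢-sym (<⇒≢ (second<N F′))))) p (shift (2 + t) k le))
      (λ F″ → unspend (2 + t) c (red-outside t (suc c) F″ (red1-mono there (red1-newʳ b≢N))
        (apart-sym (apart-fresh (bounded F′) ≤-refl (≢-sym b≢N))) (m≤n⇒m≤1+n (m≤n⇒m≤1+n p)) (shift (2 + t) k le))))
    (λ F′ → unspend₂ (2 + t) c
      (fresh-end (suc t) (suc (suc c)) F′ (<⇒≤ H) (shift (2 + t) k le))))

  -- With few vertices missing, `f` is tried at `b` directly: red makes `f` forcing and prepares a
  -- detour, blue makes `f` the new end.
  red-outside zero (suc (suc c)) F r1 ap H le = connect (swap₂ F) ap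
    (λ F′ → detour (swap₂ F′) (red1-newʳ (≢-sym (first≢first F))) (red2-new (≢-sym (first≢first F)) ap r1)
      λ _ F″ → win F″ le)
    (λ F′ → finish₁ {A = []} F′ (red1-mono there r1) none le)
  red-outside zero (suc zero) F r1 ap (s≤s (s≤s ())) le
  red-outside (suc zero) (suc (suc c)) F r1 ap H le = connect (swap₂ F) ap
    (λ F′ → let r2 = red2-new (≢-sym (first≢first F)) ap r1 in
      detour (swap₂ F′) (red1-newʳ (≢-sym (first≢first F))) r2
      λ σ F″ → extend! F″ (red2-mono σ r2) λ F₃ → win F₃ le)
    (λ F′ → finish₂ {A = []} F′ (red1-mono there r1) none le)
  red-outside (suc zero) (suc zero) F r1 ap (s≤s (s≤s ())) le
  -- A red answer makes `f` forcing, and `f` is placed between `b` and a fresh vertex: two vertices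
  -- for one red edge, so the potential is unchanged. A blue answer turns `f` into one end of a
  -- pendant edge.
  red-outside (suc (suc t)) (suc c) {N = N} {f = f} {k = k} F r1 ap (s≤s (s≤s p)) le =
    spend (4 + t) c (extend (swap₂ F)
    (λ F′ → let r2 = red2-new f≢N (fresh-apart (bounded F)) r1 in
      connect! (rot₃ (rot₃ F′)) (apart-new f<N (first<N F) ap) r2
      λ F″ → extend! F″ (red2-mono there r2)
      λ F₃ → red-outside t c F₃ (red1-mono (there ∘ there) (red1-newʳ f≢N))
        (apart-sym (apart-fresh (bounded F″) ≤-refl (≢-sym f≢N))) p
        (shift (2 + t) (suc k) (shift (3 + t) k le)))
    (λ F′ → unspend (3 + t) c
      (pendant-outside (suc t) (suc c) (swap₂ F′) (red1-mono there r1) (apart-new f<N (first<N F) ap)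
        (apart-fresh (bounded F) (first<N F) (first≢first F)) (s≤s (s≤s p)) le)))
    where
    f<N = second<N F
    f≢N = <⇒≢ f<N

  -- Both ends of the pendant edge are tried at `b`. Two red answers give `b` and `f` two red edges
  -- each, and a fresh vertex joins them.
  pendant-outside zero (suc (suc c)) {b = b} {f = f} {g = g} F r1 apf apg H le = connect (swap₂ F) apg
    (λ F′ → let apf′ = apart-off apf (≢-sym g≢f) (first≢first F) in connect (flip₁ F′) apf′
      (λ F″ → hop (swap₂ F″) (red2-newʳ f≢b apf′ (red1-newʳ g≢b)) (red2-new f≢b apf′ (red1-mono there r1))
        λ _ F₃ → win F₃ le)
      (λ F″ → finish₁ {A = []} F″ (red1-mono there (red1-new g≢b)) none le))
    (λ F′ → finish₁ {A = []} F′ (red1-mono there r1) none le)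
    where
    g≢f = ends≢ (swap₂ F)
    g≢b = ≢-sym (first≢first F)
    f≢b = ≢-sym (first≢last F)
  pendant-outside zero (suc zero) F r1 apf apg (s≤s (s≤s ())) le
  -- A red answer at `f` forces the edge from `f` to `b`, which makes `g` the end. A blue one
  -- lengthens the pendant edge to a path of three vertices whose ends are both apart from `b`.
  pendant-outside (suc t) (suc c) {N = N} {f = f} {g = g} {k = k} F r1 apf apg H@(s≤s (s≤s p)) le =
    spend (3 + t) c (extend (flip₁ (swap₂ F))
    (λ F′ → connect! (rot₃ (rot₃ F′)) (apart-new f<N (first<N F) apf)
      (red2-new f≢N (fresh-apart (bounded F)) r1)
      λ F″ → red-outside t c F″ (red1-mono there (red1-newʳ f≢N))
        (apart-off (apart-fresh (bounded F) g<N g≢f) (≢-sym f≢N) g≢f) p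
        (shift (2 + t) (suc k) (shift (3 + t) k le)))
    (λ F′ → unspend (2 + t) c
      (two-paths t (suc c) (swap₂ F′) (apart-fresh (bounded F) (first<N F) (first≢last F)) (apart-new g<N (first<N F) apg) H
        (shift (1 + t) (2 + k) (shift (2 + t) (suc k) (shift (3 + t) k le))))))
    where
    g<N = second<N F
    f<N = last<N (swap₂ F)
    f≢N = <⇒≢ f<N
    g≢f = ends≢ (swap₂ F)

  two-paths t c F apg apj H le = connect (swap₂ F) apg
    (λ F′ → two-paths-red t c F′ (red1-newʳ g≢h) (red1-new g≢h)
      (apart-off apj (≢-sym (ends≢ (swap₂ F))) (first≢first F)) H le)
    (λ F′ → fresh-end t c F′ H le)
    where g≢h = ≢-sym (first≢first F)

  -- The potential leaves at least three red edges, so the first three clauses are impossible.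
  two-paths-red t zero F r1h r1g apj () le
  two-paths-red t (suc zero) F r1h r1g apj (s≤s (s≤s ())) le
  two-paths-red t (suc (suc zero)) F r1h r1g apj (s≤s (s≤s (s≤s (s≤s ())))) le
  -- If `j` to `h` is red, `h` is forcing, and an edge from `g` to a fresh vertex links the paths at
  -- `g` and `h` whatever its colour.
  two-paths-red zero (suc (suc (suc c))) {k = k} {q = q} F r1h r1g apj H le = connect (flip₁ F) apj
    (λ F′ → let r2h = red2-newʳ j≢h apj r1h in extend (flip₁ F′)
      (λ F″ → hop (swap₂₃ (rot₃ F″)) (red2-mono there r2h)
        (red2-new (<⇒≢ (first<N F)) (fresh-apart (bounded F′)) (red1-mono there r1g))
        λ _ F₃ → win F₃ (shift (2 + q) k le))
      (λ F″ → connectʳ! F″ (apart-fresh (bounded F′) (second<N F) (≢-sym (first≢first F))) (red2-mono there r2h)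
        λ F₃ → win F₃ le))
    (λ F′ → finish₁ {A = []} F′ (red1-mono there r1g) none le)
    where j≢h = last≢first F
  two-paths-red (suc zero) (suc (suc (suc c))) {N = N} {h = h} {k = k} {q = q} F r1h r1g apj H le = extend (swap₂ F)
    (λ F′ → connectʳ! (flip₁ (swap₂₃ (rot₃ F′))) (apart-new (last<N F) h<N apj) (red2-new h≢N (fresh-apart (bounded F)) r1h)
      λ F″ → red-ends 1 (suc c) F″ (red1-mono (there ∘ there) r1g) (red1-mono there (red1-newʳ h≢N))
        (apart-off (apart-sym (apart-fresh (bounded F) (first<N F) (first≢first F))) (first≢first F) (≢-sym h≢N))
        none (s≤s (s≤s z≤n)) le)
    (λ F′ → let ap = apart-sym (apart-fresh (bounded F) (first<N F) (first≢first F)) ; g≢N = <⇒≢ (first<N F) in connect (swap₂ F′) ap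
      (λ F″ → detour (swap₂ F″) (red1-newʳ g≢N) (red2-new g≢N ap (red1-mono there r1g))
        λ _ F₃ → win F₃ (subst (ℓ ≤_) (sym (trans (+-suc (2 + q) (suc k)) (cong suc (+-suc (2 + q) k)))) le))
      (λ F″ → finish-fresh F″ (subst (ℓ ≤_) (cong suc (sym (+-suc (2 + q) k))) le)))
    where
    h<N = second<N F
    h≢N = <⇒≢ h<N
  -- A red answer at `h` forces the edge from `h` to `j`. After a blue one `g` is tried: red forces
  -- the edge from `g` to the new end, blue means that both paths have grown by one vertex.
  two-paths-red (suc (suc t)) (suc (suc (suc c))) {S} {N} {h} {g} {j} {w} {k} {q} F r1h r1g apj (s≤s (s≤s (s≤s (s≤s p)))) le =
    spend₂ (3 + t) (suc c) (extend (swap₂ F)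
    (λ F′ → connectʳ! (flip₁ (swap₂₃ (rot₃ F′))) (apart-new (last<N F) h<N apj) (red2-new h≢N (fresh-apart (bounded F)) r1h)
      λ F″ → red-ends (2 + t) (suc c) F″ (red1-mono (there ∘ there) r1g) (red1-mono there (red1-newʳ h≢N))
        (apart-off g∥N (first≢first F) (≢-sym h≢N)) none p le)
    (λ F′ → extend (swap₂ F′)
      (λ F″ → connect! (rot₃ (rot₃ F″)) (apart-new (m<n⇒m<1+n (first<N F)) ≤-refl g∥N)
        (red2-new (<⇒≢ (m<n⇒m<1+n (first<N F))) (fresh-apart (bounded F′)) (red1-mono there r1g))
        λ F₃ → red-outside t (suc c) F₃ (red1-mono there (red1-newʳ (<⇒≢ (m<n⇒m<1+n (first<N F)))))
          (apart-off (apart-fresh (bounded F′) (m<n⇒m<1+n (last<N F)) (≢-sym (ends≢ F)))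
            (≢-sym (<⇒≢ (m<n⇒m<1+n (first<N F)))) (≢-sym (ends≢ F))) p
          (subst (ℓ ≤_) (cong (2 +_) (trans (sym (+-suc t _)) (cong (t +_) (sym (+-suc (2 + q) k))))) le))
      (λ F″ → unspend (2 + t) (suc c) (two-paths t (suc (suc c)) (swap₂ F″)
        (apart-fresh (bounded F′) ≤-refl (≢-sym (<⇒≢ (first<N F))))
        (apart-new (m<n⇒m<1+n (last<N F)) ≤-refl (apart-sym (apart-fresh (bounded F) (last<N F) (last≢first F))))
        (s≤s (s≤s p))
        (subst (ℓ ≤_) (cong suc (trans (cong suc (sym (+-suc t _))) (trans (sym (+-suc t _)) (cong (λ m → t + (3 + m)) (sym (+-suc q k)))))) le)))))
    where
    h<N = second<N F
    h≢N = <⇒≢ h<N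
    g∥N : ∀ {c} → Apart ((h , N , c) ∷ S) g N
    g∥N = apart-sym (apart-fresh (bounded F) (first<N F) (first≢first F))

  red-ends t zero F r1e r1f ap sp () le
  red-ends zero (suc c) {d = d} F r1e r1f ap sp H le with spare-past sp F
  ... | _ , F′ , sp′ = finish₁ F′ r1e sp′ le
  -- If the edge from `f` to `e` is red, both become forcing; once the spare path is absorbed at
  -- `e`, a fresh vertex completes the path.
  red-ends (suc zero) (suc c) {k = k} {q = q} {d = d} F r1e r1f ap sp H le =
    cast (sym (+-suc d _)) (connect (swap₂ F) (apart-sym ap)
      (λ F′ → absorb (swap₂ F′) (red2-newʳ f≢e (apart-sym ap) r1e) (spare-swap (spare-link F sp))
        λ σ F″ r2 → hop F″ r2 (red2-mono σ (red2-new f≢e (apart-sym ap) r1f)) λ _ F₃ → win F₃ le)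
      (λ F′ → finish₁ F′ (red1-mono there r1f) (spare-link F sp) (subst (ℓ ≤_) (cong suc (sym (+-suc q k))) le)))
    where f≢e = ≢-sym (first≢first F)
  red-ends (suc (suc t)) (suc zero) F r1e r1f ap sp (s≤s (s≤s ())) le
  red-ends (suc (suc zero)) (suc (suc c)) {k = k} {q = q} {d = d} F r1e r1f ap sp H le =
    cast (sym (+-suc d _)) (connect (swap₂ F) (apart-sym ap)
      (λ F′ → let r2f = red2-new f≢e (apart-sym ap) r1f in
        absorb (swap₂ F′) (red2-newʳ f≢e (apart-sym ap) r1e) (spare-swap (spare-link F sp))
        λ σ F″ r2 → hop F″ r2 (red2-mono σ r2f) λ τ F₃ → extend! F₃ (red2-mono (τ ∘ σ) r2f) λ F₄ → win F₄ le)
      (λ F′ → finish₂ F′ (red1-mono there r1f) (spare-link F sp) (subst (ℓ ≤_) (cong (2 +_) (sym (+-suc q k))) le)))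
    where f≢e = ≢-sym (first≢first F)
  -- A red answer makes `f` forcing; with a forced neighbour it starts a spare path of two vertices.
  -- After a blue answer `e` is tried: red forces the edge from `e` to the new neighbour of `f`,
  -- blue leaves a pendant edge outside.
  red-ends (suc (suc (suc t))) (suc c) {S} {N} {e} {f} {w} {k} F r1e r1f ap none H@(s≤s (s≤s p)) le =
    spend (4 + t) c (extend (swap₂ F)
      (λ F′ → let r2f = red2-new f≢N (fresh-apart (bounded F)) r1f in extend! (swap₂ F′) r2f
        λ F″ → red-ends (suc t) c (rot₃ (swap₂ (flip₁ F″)))
          (red1-mono (there ∘ there) r1e) (red1-mono there (red1-newʳ f≢N)) (apart-new (m<n⇒m<1+n e<N) ≤-refl e∥N)
          (some (red2-mono there r2f)
            (apart-fresh (bounded F′) (m<n⇒m<1+n e<N) e≢f ∷ apart-fresh (bounded F′) ≤-refl (≢-sym f≢N) ∷ []))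
          p (shift (2 + t) (suc k) (shift (3 + t) k le)))
      (λ F′ → extend (swap₂ F′)
        (λ F″ → connectʳ! (swap₂₃ (rot₃ F″)) (apart-new ≤-refl (m<n⇒m<1+n e<N) (apart-sym e∥N))
          (red2-new e≢N′ (fresh-apart (bounded F′)) (red1-mono there r1e))
          λ F₃ → red-ends (suc t) c F₃ (red1-mono (there ∘ there ∘ there) r1f) (red1-mono there (red1-newʳ e≢N′))
            (apart-off (apart-sym (apart-fresh (bounded F′) (m<n⇒m<1+n f<N) (≢-sym e≢f))) (≢-sym e≢f) (≢-sym e≢N′))
            none p (shift (2 + t) (suc k) (shift (3 + t) k le)))
        (λ F″ → unspend (2 + t) c (pendant-outside t (suc c) F″ (red1-mono (there ∘ there) r1f)
          (apart-sym (apart-fresh (bounded F′) (m<n⇒m<1+n f<N) (≢-sym e≢f)))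
          (apart-sym (apart-fresh (bounded F′) ≤-refl (≢-sym e≢N)))
          H (shift (3 + t) k le)))))
    where
    e<N = first<N F
    f<N = second<N F
    e≢N = <⇒≢ e<N
    f≢N = <⇒≢ f<N
    e≢N′ = <⇒≢ (m<n⇒m<1+n e<N)
    e≢f = first≢first F
    e∥N : ∀ {c} → Apart ((f , N , c) ∷ S) e N
    e∥N = apart-sym (apart-fresh (bounded F) e<N e≢f)
  red-ends (suc (suc (suc t))) (suc c) {S} {N} {e} {f} {w} {k} F r1e r1f ap
    -- The moves are those without a spare path. A red answer at `f` now lengthens the spare path by
    -- `f` and a fresh vertex; otherwise the forcing vertex `z`, or `z` and `e`, absorb the spare
    -- path into the main one.
    (some {z = z} {y = y} {q = q} r2z (ye ∷ yf ∷ [])) H@(s≤s (s≤s p)) le =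
    spend (5 + t) c (extend (swap₂ F)
      (λ F′ → let r2f = red2-new f≢N (fresh-apart (bounded F)) r1f in
        connect! (rot₃ (flip₁ (rot₄ F′))) (apart-sym (apart-new y<N f<N yf)) r2f
        λ F″ → extend! F″ (red2-mono there r2f)
        λ F₃ → red-ends (suc t) c (rot₃ (swap₂ (flip₁ F₃)))
          (red1-mono (there ∘ there ∘ there) r1e) (red1-mono (there ∘ there) (red1-newʳ f≢N))
          (apart-new (m<n⇒m<1+n e<N) ≤-refl (apart-off e∥N e≢f (≢-sym f≢N)))
          (some (red2-mono (there ∘ there ∘ there) r2z)
            (apart-fresh (bounded F″) (m<n⇒m<1+n e<N) e≢f ∷ apart-fresh (bounded F″) ≤-refl (≢-sym f≢N) ∷ []))
          p (shift (2 + t) (suc (q + k)) (shift (3 + t) (q + k) le)))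
      (λ F′ → extend (swap₂ F′)
        (λ F″ → connectʳ! (flip₁ (swap₂₃ (rot₄ F″)))
          (apart-new (m<n⇒m<1+n y<N) (m<n⇒m<1+n e<N) (apart-new y<N e<N ye))
          (red2-new e≢N′ (fresh-apart (bounded F′)) (red1-mono there r1e))
          λ F₃ → connectʳ! (rot₃ F₃)
            (apart-off (apart-new ≤-refl (m<n⇒m<1+n z<N) (apart-fresh (bounded F) z<N z≢f)) (≢-sym e≢N) z≢e)
            (red2-mono (there ∘ there ∘ there) r2z)
          λ F₄ → red-ends (suc t) c F₄ (red1-mono (there ∘ there ∘ there ∘ there) r1f)
            (red1-mono (there ∘ there) (red1-newʳ e≢N′))
            (apart-off
              (apart-off (apart-sym (apart-fresh (bounded F′) (m<n⇒m<1+n f<N) (≢-sym e≢f))) (≢-sym e≢f) (≢-sym e≢N′))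
              (≢-sym z≢f) (≢-sym (<⇒≢ (m<n⇒m<1+n z<N))))
            none p (shift (2 + t) (suc (q + k)) (shift (3 + t) (q + k) le)))
        (λ F″ → connect! (rot₃ F″) (apart-sym (apart-fresh (bounded F′) (m<n⇒m<1+n z<N) z≢e))
          (red2-mono (there ∘ there) r2z)
          λ F₃ → unspend (2 + t) c (pendant-outside t (suc c) F₃ (red1-mono (there ∘ there ∘ there) r1f)
            (apart-offʳ (apart-new (m<n⇒m<1+n f<N) (m<n⇒m<1+n y<N) (apart-new f<N y<N (apart-sym yf))) f≢N′ y≢N′)
            (apart-offʳ (apart-new ≤-refl (m<n⇒m<1+n y<N) (apart-fresh (bounded F) y<N y≢f)) (<⇒≢ ≤-refl) y≢N′)
            H (subst (ℓ ≤_) (cong (3 +_) (trans (sym (+-suc t (q + k))) (cong (t +_) (sym (+-suc q k))))) le)))))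
    where
    e<N = first<N F
    f<N = second<N F
    z<N = first<N (rot₃ F)
    y<N = last<N (rot₃ F)
    e≢N = <⇒≢ e<N
    f≢N = <⇒≢ f<N
    e≢N′ = <⇒≢ (m<n⇒m<1+n e<N)
    f≢N′ = <⇒≢ (m<n⇒m<1+n f<N)
    y≢N′ = <⇒≢ (m<n⇒m<1+n y<N)
    e≢f = first≢first F
    z≢e = first≢first (rot₃ F)
    z≢f = first≢first (swap₂₃ (rot₃ F))
    y≢f = last≢first (swap₂₃ (rot₃ F))
    e∥N : ∀ {c} → Apart ((f , N , c) ∷ S) e N
    e∥N = apart-sym (apart-fresh (bounded F) e<N e≢f)

  -- Opening moves and short paths

  start : Forest [] 1 ((0 , 0 , 1) ∷ [])
  start = record { cover = [ 0 ] ∷ [] ; unique = [] ∷ [] ; below = s≤s z≤n ∷ [] ; bounded = λ () }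

builder₂ : BuilderWins K13 (Path 2) 3 []
builder₂ = finish-fresh start ≤-refl
  where open Builder 2

builder₃ : BuilderWins K13 (Path 3) 4 []
builder₃ = extend start
  (λ F → extend (swap₂ F)
    (λ F′ → let r2 = red2-new (λ ()) (fresh-apart (bounded F)) (red1-new (λ ())) in
      extend! (swap₂ F′) r2 λ F″ → extend! (flip₁ F″) (red2-mono there r2) λ F₃ → win F₃ ≤-refl)
    (λ F′ → finish₁ {A = []} (flip₁ F′) (red1-mono there (red1-new (λ ()))) none ≤-refl))
  (λ F → finish-fresh F ≤-refl)
  where open Builder 3

-- For `ℓ = 4 + m` the hypothesis reads `ℓ - 1 ≤ 2h`. The first two edges are `0` to `1` and `1` to
-- `2`, and their colours select the state. After two red answers, `1` and a forced neighbour form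
-- the spare path.
builder : ∀ m h → 3 + m ≤ h * 2 → BuilderWins K13 (Path (4 + m)) (4 + m + h) []
builder m (suc h) H@(s≤s (s≤s p)) = spend (4 + m) h (extend start
  (λ F → extend F
    (λ F′ → let r2 = red2-new (λ ()) (fresh-apart (bounded F)) (red1-newʳ (λ ())) in
      extend! (swap₂ F′) r2 λ F″ → red-ends m h (rot₃ (swap₂ (flip₁ F″)))
        (red1-mono (there ∘ there) (red1-new (λ ()))) (red1-mono there (red1-newʳ (λ ())))
        (apart-new (s≤s z≤n) (s≤s (s≤s (s≤s z≤n))) (apart-sym (apart-fresh (bounded F) (s≤s z≤n) (λ ()))))
        (some (red2-mono there r2)
          (apart-fresh (bounded F′) (s≤s z≤n) (λ ()) ∷ apart-fresh (bounded F′) (s≤s (s≤s (s≤s z≤n))) (λ ()) ∷ []))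
        p (≤-reflexive (+-comm 3 (suc m))))
    (λ F′ → unspend (2 + m) h (red-outside m (suc h) F′ (red1-mono there (red1-new (λ ())))
        (apart-sym (apart-fresh (bounded F) (s≤s z≤n) (λ ()))) H (≤-reflexive (+-comm 2 (2 + m))))))
  (λ F → extend F
    (λ F′ → unspend (2 + m) h (red-outside m (suc h) (flip₁ (swap₂ F′)) (red1-newʳ (λ ()))
        (apart-fresh (bounded F) (s≤s z≤n) (λ ())) H (≤-reflexive (+-comm 2 (2 + m)))))
    (λ F′ → unspend₂ (1 + m) h (fresh-end m (2 + h) F′ (s≤s (s≤s H)) (≤-reflexive (+-comm 3 (suc m)))))))
  where open Builder (4 + m)

-- Counting coloured edges

reds : Board → ℕ
reds []                   = 0
reds ((_ , _ , red)  ∷ S) = suc (reds S)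
reds ((_ , _ , blue) ∷ S) = reds S

blues : Board → Board
blues []                         = []
blues ((_ , _ , red)  ∷ S)       = blues S
blues (e@(_ , _ , blue) ∷ S)     = e ∷ blues S

length-split : ∀ S → length S ≡ reds S + length (blues S)
length-split []                   = refl
length-split ((_ , _ , red)  ∷ S) = cong suc (length-split S)
length-split ((_ , _ , blue) ∷ S) = trans (cong suc (length-split S)) (sym (+-suc (reds S) _))

∈-blues : (u , v , blue) ∈ S → (u , v , blue) ∈ blues S
∈-blues (here refl) = here refl
∈-blues {S = (_ , _ , red)  ∷ S} (there e) = ∈-blues e
∈-blues {S = (_ , _ , blue) ∷ S} (there e) = there (∈-blues e)

edge-blues : EdgeCol S blue u v → EdgeCol (blues S) blue u v
edge-blues (inj₁ e) = inj₁ (∈-blues e)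
edge-blues (inj₂ e) = inj₂ (∈-blues e)

avoids? : ∀ a (e : ℕ × ℕ × Colour) → Dec (proj₁ e ≢ a × proj₁ (proj₂ e) ≢ a)
avoids? a (x , y , _) = ¬? (x ≟ a) ×-dec ¬? (y ≟ a)

edge-filter : ∀ a → u ≢ a → v ≢ a → EdgeCol S c u v → EdgeCol (filter (avoids? a) S) c u v
edge-filter a u≢a v≢a (inj₁ e) = inj₁ (∈-filter⁺ (avoids? a) e (u≢a , v≢a))
edge-filter a u≢a v≢a (inj₂ e) = inj₂ (∈-filter⁺ (avoids? a) e (v≢a , u≢a))

linked-filter : All (a ≢_) xs → Linked (EdgeCol S c) xs → Linked (EdgeCol (filter (avoids? a) S) c) xs
linked-filter _                    []       = []
linked-filter _                    [-]      = [-]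
linked-filter (a≢x ∷ a≢y ∷ a∉) (e ∷ L) =
  edge-filter _ (≢-sym a≢x) (≢-sym a≢y) e ∷ linked-filter (a≢y ∷ a∉) L

-- Removing the first vertex of the path with all its edges loses at least one edge.
linked-length : ∀ S → Linked (EdgeCol S c) xs → Unique xs → length xs ≤ suc (length S)
linked-length S []  _ = z≤n
linked-length S [-] _ = s≤s z≤n
linked-length {c = c} {xs = a ∷ b ∷ xs} S (e ∷ L) (a∉ ∷ uniq) = s≤s (≤-trans
  (linked-length (filter (avoids? a) S) (linked-filter a∉ L) uniq)
  (filter-notAll (avoids? a) S (meets e)))
  where
  meets : EdgeCol S c a b → Any.Any (λ e → ¬ (proj₁ e ≢ a × proj₁ (proj₂ e) ≢ a)) S
  meets (inj₁ e) = lose e (λ p → proj₁ p refl)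
  meets (inj₂ e) = lose e (λ p → proj₂ p refl)

tabulate-linked : ∀ {R : ℕ → ℕ → Set} {n} (f : Fin n → ℕ) →
                  (∀ i j → toℕ j ≡ suc (toℕ i) → R (f i) (f j)) → Linked R (tabulate f)
tabulate-linked {n = zero}        f r = []
tabulate-linked {n = suc zero}    f r = [-]
tabulate-linked {n = suc (suc n)} f r =
  r fzero (fsuc fzero) refl ∷ tabulate-linked (f ∘ fsuc) (λ i j eq → r (fsuc i) (fsuc j) (cong suc eq))

copy-path : HasCopy S c (Path ℓ) → ∃ λ xs → length xs ≡ ℓ × Unique xs × Linked (EdgeCol S c) xs
copy-path (f , inj , adj) =
  tabulate f , length-tabulate f , tabulate⁺ inj , tabulate-linked f (λ i j eq → adj i j (inj₁ eq))

-- Red degrees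

other : {P : Set} → Dec P → ℕ → List ℕ
other (yes _) y = y ∷ []
other (no  _) y = []

nbrs : Board → ℕ → List ℕ
nbrs []                   v = []
nbrs ((x , y , red)  ∷ S) v = other (x ≟ v) y ++ other (y ≟ v) x ++ nbrs S v
nbrs ((_ , _ , blue) ∷ S) v = nbrs S v

deg : Board → ℕ → ℕ
deg S v = length (nbrs S v)

nbrs-complete : ∀ S → EdgeCol S red u v → v ∈ nbrs S u
nbrs-complete {u} {v} ((x , y , red) ∷ S) (inj₁ (here refl)) with x ≟ x
... | yes _  = here refl
... | no ¬p  = contradiction refl ¬p
nbrs-complete {u} {v} ((x , y , red) ∷ S) (inj₂ (here refl)) = ∈-++⁺ʳ (other (x ≟ u) y) (second (y ≟ y))
  where
  second : (d : Dec (y ≡ y)) → x ∈ other d x ++ nbrs S y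
  second (yes _) = here refl
  second (no ¬p) = contradiction refl ¬p
nbrs-complete {u} {v} ((x , y , red) ∷ S) (inj₁ (there e)) = ∈-++⁺ʳ (other (x ≟ u) y) (∈-++⁺ʳ (other (y ≟ u) x) (nbrs-complete S (inj₁ e)))
nbrs-complete {u} {v} ((x , y , red) ∷ S) (inj₂ (there e)) = ∈-++⁺ʳ (other (x ≟ u) y) (∈-++⁺ʳ (other (y ≟ u) x) (nbrs-complete S (inj₂ e)))
nbrs-complete ((_ , _ , blue) ∷ S) (inj₁ (there e)) = nbrs-complete S (inj₁ e)
nbrs-complete ((_ , _ , blue) ∷ S) (inj₂ (there e)) = nbrs-complete S (inj₂ e)

unique-⊆-length : Unique xs → xs ⊆ ys → length xs ≤ length ys
unique-⊆-length {[]}     _           _  = z≤n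
unique-⊆-length {x ∷ xs} (x∉ ∷ uniq) σ with ∈-∃++ (σ (here refl))
... | ps , qs , refl = ≤-trans (s≤s (unique-⊆-length uniq τ)) (≤-reflexive eq)
  where
  τ : xs ⊆ ps ++ qs
  τ z∈ with ∈-++⁻ ps (σ (there z∈))
  ... | inj₁ z∈ps         = ∈-++⁺ˡ z∈ps
  ... | inj₂ (here refl)  = contradiction refl (All.lookup x∉ z∈)
  ... | inj₂ (there z∈qs) = ∈-++⁺ʳ ps z∈qs
  eq : suc (length (ps ++ qs)) ≡ length (ps ++ x ∷ qs)
  eq = trans (cong suc (length-++ ps)) (trans (sym (+-suc _ _)) (sym (length-++ ps)))

star-degree : HasCopy S red K13 → ∃ λ v → 3 ≤ deg S v
star-degree {S} (f , inj , adj) = f fzero , unique-⊆-length uniq sub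
  where
  i₁ i₂ i₃ : Fin 4
  i₁ = fsuc fzero
  i₂ = fsuc (fsuc fzero)
  i₃ = fsuc (fsuc (fsuc fzero))
  leaves : List ℕ
  leaves = f i₁ ∷ f i₂ ∷ f i₃ ∷ []
  ne : ∀ i j → i ≢ j → f i ≢ f j
  ne i j i≢j eq = i≢j (inj eq)
  uniq : Unique leaves
  uniq = (ne i₁ i₂ (λ ()) ∷ ne i₁ i₃ (λ ()) ∷ []) ∷ (ne i₂ i₃ (λ ()) ∷ []) ∷ [] ∷ []
  leaf : ∀ i → i ≢ fzero → f i ∈ nbrs S (f fzero)
  leaf i i≢ = nbrs-complete S (adj fzero i (inj₁ (refl , i≢)))
  sub : leaves ⊆ nbrs S (f fzero)
  sub (here refl)                 = leaf i₁ (λ ())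
  sub (there (here refl))         = leaf i₂ (λ ())
  sub (there (there (here refl))) = leaf i₃ (λ ())

-- The indicator of `x ≡ v`: what an edge end `x` contributes to the degree of `v`.
δ : ℕ → ℕ → ℕ
δ x v = length (other (x ≟ v) x)

δ-same : ∀ v → δ v v ≡ 1
δ-same v with v ≟ v
... | yes _ = refl
... | no ¬p = contradiction refl ¬p

δ-diff : x ≢ v → δ x v ≡ 0
δ-diff {x} {v} x≢v with x ≟ v
... | yes p = contradiction p x≢v
... | no _  = refl

length-other : ∀ x v y → length (other (x ≟ v) y) ≡ δ x v
length-other x v y with x ≟ v
... | yes _ = refl
... | no  _ = refl

deg-red : ∀ x y S v → deg ((x , y , red) ∷ S) v ≡ δ x v + δ y v + deg S v
deg-red x y S v
  rewrite length-++ (other (x ≟ v) y) {other (y ≟ v) x ++ nbrs S v} | length-++ (other (y ≟ v) x) {nbrs S v}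
        | length-other x v y | length-other y v x = sym (+-assoc (δ x v) (δ y v) _)

sum-δ : ∀ x → Unique xs → sum (map (δ x) xs) ≤ 1
sum-δ {[]}     x _ = z≤n
sum-δ {v ∷ xs} x (v∉ ∷ uniq) with x ≟ v
... | yes refl = s≤s (≤-reflexive (zeros xs v∉))
  where
  zeros : ∀ ys → All (x ≢_) ys → sum (map (δ x) ys) ≡ 0
  zeros []       _           = refl
  zeros (y ∷ ys) (x≢y ∷ x∉) rewrite δ-diff x≢y = zeros ys x∉
... | no _     = sum-δ x uniq

sum-map-+ : ∀ (f g : ℕ → ℕ) xs → sum (map (λ v → f v + g v) xs) ≡ sum (map f xs) + sum (map g xs)
sum-map-+ f g []       = refl
sum-map-+ f g (x ∷ xs) rewrite sum-map-+ f g xs = interchange (f x) (g x) _ _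

sum-cong : ∀ {f g : ℕ → ℕ} → (∀ v → f v ≡ g v) → ∀ xs → sum (map f xs) ≡ sum (map g xs)
sum-cong eq []       = refl
sum-cong eq (x ∷ xs) = cong₂ _+_ (eq x) (sum-cong eq xs)

weight : Board → List ℕ → ℕ
weight S xs = sum (map (deg S) xs)

-- Each end of a red edge counts at most once, since the entries are distinct. Ends off the list do
-- not count, hence only an inequality.
handshake : ∀ S → Unique xs → weight S xs ≤ reds S * 2
handshake {xs} [] uniq = ≤-reflexive (zeros xs)
  where
  zeros : ∀ xs → weight [] xs ≡ 0
  zeros []       = refl
  zeros (x ∷ xs) = zeros xs
handshake {xs} ((x , y , red)  ∷ S) uniq
  rewrite sum-cong (deg-red x y S) xs | sum-map-+ (λ v → δ x v + δ y v) (deg S) xs | sum-map-+ (δ x) (δ y) xs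
  = +-mono-≤ (+-mono-≤ (sum-δ x uniq) (sum-δ y uniq)) (handshake S uniq)
handshake ((_ , _ , blue) ∷ S) uniq = handshake S uniq

-- Weights along the blue path

-- Here `a` and `b` are the two ends of one red path, and `another` is the third vertex of red
-- degree 1 that the counting rules out.
record Pair (S : Board) (p : ℕ → ℕ) (a b : ℕ) : Set where
  field
    end₁    : deg S a ≡ 1
    end₂    : deg S b ≡ 1
    mate₁   : p a ≡ b
    mate₂   : p b ≡ a
    another : ∃ λ z → deg S z ≡ 1 × z ≢ a × z ≢ b
open Pair

Link : Board → (ℕ → ℕ) → ℕ → ℕ → Set
Link S p a b = deg S a ≡ 2 ⊎ deg S b ≡ 2 ⊎ Pair S p a b

Heavy : Board → ℕ → ℕ → Set
Heavy S a b = 2 ≤ deg S a + deg S b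

-- The path is cut into `k` disjoint pairs of consecutive vertices, each of weight at least 2.
weight-even : ∀ S k → Linked (Heavy S) xs → length xs ≡ k * 2 → k * 2 ≤ weight S xs
weight-even S zero    L             eq = z≤n
weight-even S (suc k) [-]           ()
weight-even S (suc k) (_∷_ {x = a} {b} {ys} l L) eq = ≤-trans
  (+-mono-≤ l (weight-even S k (Linked.tail L) (suc-injective (suc-injective eq))))
  (≤-reflexive (+-assoc (deg S a) (deg S b) (weight S ys)))

weight-odd : ∀ S k → Linked (Heavy S) xs → length xs ≡ suc (k * 2) → k * 2 ≤ weight S xs
weight-odd {x ∷ xs} S k L eq = m≤n⇒m≤o+n (deg S x) (weight-even S k (Linked.tail L) (suc-injective eq))

module _ {S : Board} {p : ℕ → ℕ} where

  link-weight : Link S p a b → Heavy S a b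
  link-weight (inj₁ eq)        rewrite eq = m≤m+n 2 _
  link-weight {a} (inj₂ (inj₁ eq)) rewrite eq = m≤n+m 2 (deg S a)
  link-weight (inj₂ (inj₂ π))  rewrite end₁ π | end₂ π = ≤-refl

  link-sym : Link S p a b → Link S p b a
  link-sym (inj₁ eq)        = inj₂ (inj₁ eq)
  link-sym (inj₂ (inj₁ eq)) = inj₁ eq
  link-sym (inj₂ (inj₂ π))  = inj₂ (inj₂ record
    { end₁ = end₂ π ; end₂ = end₁ π ; mate₁ = mate₂ π ; mate₂ = mate₁ π
    ; another = let z , d , z≢a , z≢b = another π in z , d , z≢b , z≢a })

  heavy : Linked (Link S p) xs → Linked (Heavy S) xs
  heavy = Linked.map link-weight

  pair-rest : ∀ k → Linked (Link S p) (b ∷ xs) → length xs ≡ k * 2 →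
              deg S a + (deg S b + weight S xs) ≤ suc k * 2 → deg S a + deg S b ≤ 2
  pair-rest {b = b} {xs = xs} {a = a} k L eq le = +-cancelʳ-≤ (weight S xs) _ 2 (≤-trans
    (≤-reflexive (+-assoc (deg S a) (deg S b) (weight S xs)))
    (≤-trans le (+-monoʳ-≤ 2 (weight-even S k (heavy (Linked.tail L)) eq))))

  -- If the weight is as small as possible and the first vertex does not cover its edge,
  -- then the following weights are forced to be 2, 0, 2, 0, ….
  no-end : ∀ k → Linked (Link S p) (a ∷ xs) → length xs ≡ k * 2 → weight S xs ≤ k * 2 →
           deg S a ≢ 2 → (∀ {b} → b ∈ xs → ¬ Pair S p a b) → z ∈ xs → deg S z ≢ 1
  no-end zero [-] eq le a≢2 alone ()
  no-end (suc k) (_ ∷ [-]) () le a≢2 alone z∈ dz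
  no-end (suc k) (inj₁ a≡2 ∷ _) eq le a≢2 alone z∈ dz = a≢2 a≡2
  no-end (suc k) (inj₂ (inj₂ π) ∷ _) eq le a≢2 alone z∈ dz = alone (here refl) π
  no-end {z = z} (suc k) (_∷_ {y = b} {xs = c ∷ ys} (inj₂ (inj₁ b≡2)) (l ∷ L)) eq le a≢2 alone z∈ dz = cases z∈
    where
    eq′ : length ys ≡ k * 2
    eq′ = suc-injective (suc-injective eq)
    c≡0 : deg S c ≡ 0
    c≡0 = n≤0⇒n≡0 (+-cancelˡ-≤ 2 _ 0 (subst (λ d → d + deg S c ≤ 2) b≡2 (pair-rest {a = b} k L eq′ le)))
    le′ : weight S ys ≤ k * 2
    le′ = +-cancelˡ-≤ 2 _ _ (subst (λ d → d + weight S ys ≤ suc k * 2) b≡2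
            (subst (λ d → deg S b + (d + weight S ys) ≤ suc k * 2) c≡0 le))
    cases : z ∈ b ∷ c ∷ ys → ⊥
    cases (here refl)         = contradiction (trans (sym b≡2) dz) λ ()
    cases (there (here refl)) = contradiction (trans (sym c≡0) dz) λ ()
    cases (there (there z∈))  = no-end k L eq′ le′ (λ c≡2 → contradiction (trans (sym c≡0) c≡2) λ ())
      (λ _ π → contradiction (trans (sym c≡0) (end₁ π)) λ ()) z∈ dz

  -- The vertices after the first already weigh `k * 2`, so the first has degree 0 and `no-end`
  -- applies to it.
  tight-odd : ∀ k → Linked (Link S p) xs → length xs ≡ suc (k * 2) → weight S xs ≤ k * 2 → z ∈ xs → deg S z ≢ 1
  tight-odd {a ∷ xs} {z} k L eq le z∈ dz = cases z∈
    where
    eq′ : length xs ≡ k * 2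
    eq′ = suc-injective eq
    a≡0 : deg S a ≡ 0
    a≡0 = n≤0⇒n≡0 (+-cancelʳ-≤ (weight S xs) _ 0 (≤-trans le (weight-even S k (heavy (Linked.tail L)) eq′)))
    cases : z ∈ a ∷ xs → ⊥
    cases (here refl) = contradiction (trans (sym a≡0) dz) λ ()
    cases (there z∈)  = no-end k L eq′ (≤-trans (m≤n+m _ (deg S a)) le)
      (λ a≡2 → contradiction (trans (sym a≡0) a≡2) λ ())
      (λ _ π → contradiction (trans (sym a≡0) (end₁ π)) λ ()) z∈ dz

  -- The first pair weighs exactly 2. If one of its vertices has degree 2, the other has degree 0,
  -- and the induction continues behind them. If it is a `Pair`, its second vertex has its mate
  -- behind it, so `no-end` excludes the third vertex of degree 1.
  tight-even : ∀ k → Linked (Link S p) xs → Unique xs → length xs ≡ k * 2 → weight S xs ≤ k * 2 →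
               (∀ {z} → deg S z ≡ 1 → z ∈ xs) → deg S z ≢ 1
  tight-even {xs = []} zero L uniq eq le all dz with all dz
  ... | ()
  tight-even (suc k) [-] uniq () le all dz
  tight-even {xs = a ∷ b ∷ ys} (suc k) (l ∷ L) ((a≢b ∷ a∉) ∷ b∉ ∷ uniq) eq le all dz = cases l
    where
    eq′ : length ys ≡ k * 2
    eq′ = suc-injective (suc-injective eq)
    ab≤2 : deg S a + deg S b ≤ 2
    ab≤2 = pair-rest {a = a} k L eq′ le
    le′ : weight S ys ≤ k * 2
    le′ = +-cancelˡ-≤ 2 _ _ (≤-trans (+-monoˡ-≤ (weight S ys) (link-weight l))
            (≤-trans (≤-reflexive (+-assoc (deg S a) (deg S b) (weight S ys))) le))
    later : deg S a ≢ 1 → deg S b ≢ 1 → ∀ {z} → deg S z ≡ 1 → z ∈ ys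
    later a≢1 b≢1 dz with all dz
    ... | here refl         = contradiction dz a≢1
    ... | there (here refl) = contradiction dz b≢1
    ... | there (there z∈)  = z∈
    cases : Link S p a b → ⊥
    cases (inj₁ a≡2) = tight-even k (Linked.tail L) uniq eq′ le′
      (later (λ e → contradiction (trans (sym a≡2) e) λ ()) (λ b≡1 → contradiction (subst₂ (λ m n → m + n ≤ 2) a≡2 b≡1 ab≤2) λ { (s≤s (s≤s ())) })) dz
    cases (inj₂ (inj₁ b≡2)) = tight-even k (Linked.tail L) uniq eq′ le′
      (later (λ a≡1 → contradiction (subst₂ (λ m n → m + n ≤ 2) a≡1 b≡2 ab≤2) λ { (s≤s (s≤s ())) }) (λ e → contradiction (trans (sym b≡2) e) λ ())) dz
    cases (inj₂ (inj₂ π)) with another π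
    ... | w , dw , w≢a , w≢b with all dw
    ... | here w≡a         = w≢a w≡a
    ... | there (here w≡b) = w≢b w≡b
    ... | there (there w∈) = no-end k L eq′ le′ (λ b≡2 → contradiction (trans (sym (end₂ π)) b≡2) λ ())
            (λ v∈ ρ → All.lookup a∉ v∈ (trans (sym (mate₂ π)) (mate₁ ρ))) w∈ dw

-- Painter's strategy

-- A red edge from `u` to `v` merges two red paths, and their far ends `p u` and `p v` become mates.
relink : (ℕ → ℕ) → ℕ → ℕ → ℕ → ℕ
relink p u v z with z ≟ p u | z ≟ p v
... | yes _ | _     = p v
... | no  _ | yes _ = p u
... | no  _ | no  _ = p z

relink-first : ∀ p u v → relink p u v (p u) ≡ p v
relink-first p u v with p u ≟ p u
... | yes _ = refl
... | no ¬q = contradiction refl ¬q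

relink-second : ∀ p u v → p v ≢ p u → relink p u v (p v) ≡ p u
relink-second p u v ne with p v ≟ p u | p v ≟ p v
... | yes q | _     = contradiction q ne
... | no _  | yes _ = refl
... | no _  | no ¬q = contradiction refl ¬q

relink-off : ∀ p u v → z ≢ p u → z ≢ p v → relink p u v z ≡ p z
relink-off {z} p u v z≢pu z≢pv with z ≟ p u | z ≟ p v
... | yes q | _     = contradiction q z≢pu
... | no _  | yes q = contradiction q z≢pv
... | no _  | no _  = refl

deg-off : ∀ S → z ≢ u → z ≢ v → deg ((u , v , red) ∷ S) z ≡ deg S z
deg-off {z} {u} {v} S z≢u z≢v rewrite deg-red u v S z | δ-diff (≢-sym z≢u) | δ-diff (≢-sym z≢v) = refl

deg-first : ∀ S → u ≢ v → deg ((u , v , red) ∷ S) u ≡ suc (deg S u)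
deg-first {u} {v} S u≢v rewrite deg-red u v S u | δ-same u | δ-diff (≢-sym u≢v) = refl

deg-second : ∀ S → u ≢ v → deg ((u , v , red) ∷ S) v ≡ suc (deg S v)
deg-second {u} {v} S u≢v rewrite deg-red u v S v | δ-same v | δ-diff u≢v = refl

deg-red-≤2 : ∀ S → u ≢ v → deg S u ≤ 1 → deg S v ≤ 1 → (∀ z → deg S z ≤ 2) → ∀ z → deg ((u , v , red) ∷ S) z ≤ 2
deg-red-≤2 {u} {v} S u≢v du dv d≤2 z with z ≟ u | z ≟ v
... | yes refl | _        = ≤-trans (≤-reflexive (deg-first S u≢v)) (s≤s du)
... | no _     | yes refl = ≤-trans (≤-reflexive (deg-second S u≢v)) (s≤s dv)
... | no z≢u   | no z≢v   = ≤-trans (≤-reflexive (deg-off S z≢u z≢v)) (d≤2 z)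

≤2-cases : n ≤ 2 → n ≡ 2 ⊎ n ≤ 1
≤2-cases {zero}              _                   = inj₂ z≤n
≤2-cases {suc zero}          _                   = inj₂ ≤-refl
≤2-cases {suc (suc zero)}    _                   = inj₁ refl
≤2-cases {suc (suc (suc _))} (s≤s (s≤s ()))

≤1-cases : n ≤ 1 → n ≡ 0 ⊎ n ≡ 1
≤1-cases {zero}        _        = inj₁ refl
≤1-cases {suc zero}    _        = inj₂ refl
≤1-cases {suc (suc _)} (s≤s ())

-- The red components are paths; p exchanges the two ends of each of them and fixes the isolated vertices.
record Mates (S : Board) (p : ℕ → ℕ) : Set where
  field
    deg≤2    : ∀ v → deg S v ≤ 2
    isolated : ∀ {v} → deg S v ≡ 0 → p v ≡ v
    proper   : ∀ {v} → deg S v ≡ 1 → p v ≢ v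
    end      : ∀ {v} → deg S v ≡ 1 → deg S (p v) ≡ 1
    mate     : ∀ {v} → deg S v ≡ 1 → p (p v) ≡ v

  involutive : deg S v ≤ 1 → p (p v) ≡ v
  involutive {v} d with ≤1-cases d
  ... | inj₁ d0 = trans (cong p (isolated d0)) (isolated d0)
  ... | inj₂ d1 = mate d1

  not-mate-sym : deg S u ≤ 1 → deg S v ≤ 1 → p u ≢ v → p v ≢ u
  not-mate-sym du dv pu≢v refl = pu≢v (involutive dv)

  mates-injective : deg S u ≤ 1 → deg S v ≤ 1 → p u ≡ p v → u ≡ v
  mates-injective du dv eq = trans (sym (involutive du)) (trans (cong p eq) (involutive dv))

  -- If `u` was isolated, then `p u` is `u` itself, and the new edge raises its degree to 1.
  -- Otherwise the edge misses `p u`.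
  mate-end : u ≢ v → deg S u ≤ 1 → p u ≢ v → deg ((u , v , red) ∷ S) (p u) ≡ 1
  mate-end u≢v du pu≢v with ≤1-cases du
  ... | inj₁ d0 rewrite isolated d0 = trans (deg-first S u≢v) (cong suc d0)
  ... | inj₂ d1 = trans (deg-off S (proper d1) pu≢v) (end d1)

open Mates

module _ {S : Board} {p : ℕ → ℕ} (M : Mates S p) (u≢v : u ≢ v)
         (du : deg S u ≤ 1) (dv : deg S v ≤ 1) (pu≢v : p u ≢ v) where

  private
    S₊ = (u , v , red) ∷ S
    p₊ = relink p u v

    pv≢u : p v ≢ u
    pv≢u = not-mate-sym M du dv pu≢v

    pv≢pu : p v ≢ p u
    pv≢pu eq = u≢v (sym (mates-injective M dv du eq))

    end-u : deg S₊ (p u) ≡ 1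
    end-u = mate-end M u≢v du pu≢v

    end-v : deg S₊ (p v) ≡ 1
    end-v with ≤1-cases dv
    ... | inj₁ d0 rewrite isolated M d0 = trans (deg-second S u≢v) (cong suc d0)
    ... | inj₂ d1 = trans (deg-off S pv≢u (proper M d1)) (end M d1)

    off-mates : z ≢ u → deg S z ≤ 1 → z ≢ v → p z ≢ p u × p z ≢ p v
    off-mates z≢u dz z≢v = (λ eq → z≢u (mates-injective M dz du eq)) , (λ eq → z≢v (mates-injective M dz dv eq))

    mate-off : z ≢ p u → z ≢ p v → deg S z ≤ 1 → p z ≢ u × p z ≢ v
    mate-off z≢pu z≢pv dz =
      (λ eq → z≢pu (trans (sym (involutive M dz)) (cong p eq))) , (λ eq → z≢pv (trans (sym (involutive M dz)) (cong p eq)))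

    -- After the merge a vertex is an end of the new path, a former end that became an inner vertex,
    -- or none of the four vertices concerned.
    data Kind (z : ℕ) : Set where
      is-pu : z ≡ p u → Kind z
      is-pv : z ≡ p v → Kind z
      is-u  : z ≡ u → deg S u ≡ 1 → Kind z
      is-v  : z ≡ v → deg S v ≡ 1 → Kind z
      old   : z ≢ u → z ≢ v → z ≢ p u → z ≢ p v → Kind z

    kind : ∀ z → Kind z
    kind z with z ≟ p u | z ≟ p v | z ≟ u | z ≟ v
    ... | yes q | _     | _        | _        = is-pu q
    ... | no _  | yes q | _        | _        = is-pv q
    ... | no ¬q | no _  | yes refl | _        = is-u refl ([ (λ d0 → contradiction (sym (isolated M d0)) ¬q) , id ]′ (≤1-cases du))
    ... | no _  | no ¬q | no _     | yes refl = is-v refl ([ (λ d0 → contradiction (sym (isolated M d0)) ¬q) , id ]′ (≤1-cases dv))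
    ... | no a  | no b  | no c     | no d     = old c d a b

    deg-u : deg S u ≡ 1 → deg S₊ u ≡ 2
    deg-u d = trans (deg-first S u≢v) (cong suc d)

    deg-v : deg S v ≡ 1 → deg S₊ v ≡ 2
    deg-v d = trans (deg-second S u≢v) (cong suc d)

    p₊pu : p₊ (p u) ≡ p v
    p₊pu = relink-first p u v

    p₊pv : p₊ (p v) ≡ p u
    p₊pv = relink-second p u v pv≢pu

  mates-red : Mates S₊ p₊
  mates-red .deg≤2 = deg-red-≤2 S u≢v du dv (deg≤2 M)
  mates-red .isolated {z} dz with kind z
  ... | is-pu refl   = contradiction (trans (sym dz) end-u) λ ()
  ... | is-pv refl   = contradiction (trans (sym dz) end-v) λ ()
  ... | is-u refl d1 = contradiction (trans (sym dz) (deg-u d1)) λ ()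
  ... | is-v refl d1 = contradiction (trans (sym dz) (deg-v d1)) λ ()
  ... | old a b c d  = trans (relink-off p u v c d) (isolated M (trans (sym (deg-off S a b)) dz))
  mates-red .proper {z} dz with kind z
  ... | is-pu refl   = λ eq → pv≢pu (trans (sym p₊pu) eq)
  ... | is-pv refl   = λ eq → pv≢pu (sym (trans (sym p₊pv) eq))
  ... | is-u refl d1 = contradiction (trans (sym dz) (deg-u d1)) λ ()
  ... | is-v refl d1 = contradiction (trans (sym dz) (deg-v d1)) λ ()
  ... | old a b c d  = λ eq → proper M (trans (sym (deg-off S a b)) dz) (trans (sym (relink-off p u v c d)) eq)
  mates-red .end {z} dz with kind z
  ... | is-pu refl   = trans (cong (deg S₊) p₊pu) end-v
  ... | is-pv refl   = trans (cong (deg S₊) p₊pv) end-u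
  ... | is-u refl d1 = contradiction (trans (sym dz) (deg-u d1)) λ ()
  ... | is-v refl d1 = contradiction (trans (sym dz) (deg-v d1)) λ ()
  ... | old a b c d  = trans (cong (deg S₊) (relink-off p u v c d)) (trans (deg-off S (proj₁ off) (proj₂ off)) (end M dz₀))
    where
    dz₀ : deg S z ≡ 1
    dz₀ = trans (sym (deg-off S a b)) dz
    off = mate-off c d (≤-reflexive dz₀)
  mates-red .mate {z} dz with kind z
  ... | is-pu refl   = trans (cong p₊ p₊pu) p₊pv
  ... | is-pv refl   = trans (cong p₊ p₊pv) p₊pu
  ... | is-u refl d1 = contradiction (trans (sym dz) (deg-u d1)) λ ()
  ... | is-v refl d1 = contradiction (trans (sym dz) (deg-v d1)) λ ()
  ... | old a b c d  = trans (cong p₊ (relink-off p u v c d)) (trans (relink-off p u v (proj₁ off) (proj₂ off)) (mate M dz₀))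
    where
    dz₀ : deg S z ≡ 1
    dz₀ = trans (sym (deg-off S a b)) dz
    off = off-mates a (≤-reflexive dz₀) b

  -- If neither a nor b is hit, the end p u of the new red path is a third vertex of red degree 1.
  pair-red : deg S a ≡ 1 → deg S b ≡ 1 → p a ≡ b → p b ≡ a → Link S₊ p₊ a b
  pair-red {a} {b} da db pa≡b pb≡a with a ≟ u | a ≟ v | b ≟ u | b ≟ v
  ... | yes refl | _        | _        | _        = inj₁ (deg-u da)
  ... | no _     | yes refl | _        | _        = inj₁ (deg-v da)
  ... | no _     | no _     | yes refl | _        = inj₂ (inj₁ (deg-u db))
  ... | no _     | no _     | no _     | yes refl = inj₂ (inj₁ (deg-v db))
  ... | no a≢u   | no a≢v   | no b≢u   | no b≢v   = inj₂ (inj₂ record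
    { end₁ = trans (deg-off {u = u} {v = v} S a≢u a≢v) da ; end₂ = trans (deg-off {u = u} {v = v} S b≢u b≢v) db
    ; mate₁ = trans (relink-off p u v (proj₁ offb) (proj₂ offb)) pa≡b
    ; mate₂ = trans (relink-off p u v (proj₁ offa) (proj₂ offa)) pb≡a
    ; another = p u , end-u , ≢-sym (proj₁ offb) , ≢-sym (proj₁ offa) })
    where
    offa : b ≢ p u × b ≢ p v
    offa = subst (λ m → m ≢ p u × m ≢ p v) pa≡b (off-mates a≢u (≤-reflexive da) a≢v)
    offb : a ≢ p u × a ≢ p v
    offb = subst (λ m → m ≢ p u × m ≢ p v) pb≡a (off-mates b≢u (≤-reflexive db) b≢v)

  full-red : deg S a ≡ 2 → deg S₊ a ≡ 2
  full-red {a} da = trans (deg-off {u = u} {v = v} S (λ { refl → too-big du }) (λ { refl → too-big dv })) da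
    where
    too-big : deg S a ≤ 1 → ⊥
    too-big d rewrite da with d
    ... | s≤s ()

  alive-red : ∃ λ z → deg S₊ z ≡ 1
  alive-red = p u , end-u

-- A closing edge joins the ends of a red path.  Painter plays it blue only before the h-th red
-- edge, and the next red edge then leaves a third vertex of red degree 1 or covers the edge.
data Covered (S : Board) (p : ℕ → ℕ) (h : ℕ) (a b : ℕ) : Set where
  link    : Link S p a b → Covered S p h a b
  closing : reds S < h → deg S a ≡ 1 → deg S b ≡ 1 → p a ≡ b → p b ≡ a → Covered S p h a b

-- The field `alive` supplies the vertex of red degree 1 that the tight counting contradicts.
record Position (S : Board) (p : ℕ → ℕ) (h : ℕ) : Set where
  field
    mates   : Mates S p
    reds≤h  : reds S ≤ h
    alive   : reds S ≡ 0 ⊎ ∃ λ z → deg S z ≡ 1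
    covered : ∀ {a b} → (a , b , blue) ∈ S → Covered S p h a b
open Position

-- Painter's replies and the lower bound

module Painter (ℓ h : ℕ) (h≥1 : 1 ≤ h) (parity : ℓ ≡ h * 2 ⊎ ℓ ≡ suc (h * 2)) where

  many-blues : HasCopy S blue (Path ℓ) → ℓ ≤ suc (length (blues S))
  many-blues {S} C with copy-path C
  ... | xs , refl , uniq , L = linked-length (blues S) (Linked.map edge-blues L) uniq

  no-star : (∀ v → deg S v ≤ 2) → ¬ HasCopy S red K13
  no-star d≤2 C with star-degree C
  ... | v , d = <-irrefl refl (≤-trans d (d≤2 v))

  -- A blue `P_ℓ` needs `ℓ - 1` blue edges, which together with at least `h + 1` red ones makes
  -- `ℓ + h` rounds.
  all-blue : (∀ v → deg S v ≤ 2) → h < reds S → n + length S < ℓ + h → ¬ BuilderWins K13 (Path ℓ) n S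
  all-blue d≤2 R lt (done (inj₁ C)) = no-star d≤2 C
  all-blue {S} {n} d≤2 R lt (done (inj₂ C)) = <-irrefl refl (≤-trans lt (begin
    ℓ + h                             ≤⟨ +-monoˡ-≤ h (many-blues {S} C) ⟩
    suc (length (blues S)) + h        ≡⟨ cong suc (+-comm _ h) ⟩
    suc h + length (blues S)          ≤⟨ +-monoˡ-≤ _ R ⟩
    reds S + length (blues S)         ≡⟨ length-split S ⟨
    length S                          ≤⟨ m≤n+m _ n ⟩
    n + length S                      ∎))
    where open ≤-Reasoning
  all-blue {S} d≤2 R lt (step {n} u v _ _ next) =
    all-blue {(u , v , blue) ∷ S} d≤2 R (subst (_< ℓ + h) (sym (+-suc n (length S))) lt) (next blue)

  -- With fewer than `h` red edges the bounds on the weight contradict each other. With exactly `h`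
  -- they coincide, and the tight cases exclude the vertex from `alive`.
  no-path : ∀ {p} → Position S p h → ¬ HasCopy S blue (Path ℓ)
  no-path {S} {p} P C with copy-path C
  ... | xs , len , uniq , L = contra (m≤n⇒m<n∨m≡n (reds≤h P))
    where
    covers : ∀ {a b} → EdgeCol S blue a b → Covered S p h a b
    covers (inj₁ e) = covered P e
    covers (inj₂ e) with covered P e
    ... | link l                = link (link-sym l)
    ... | closing lt da db π ρ = closing lt db da ρ π

    upper : weight S xs ≤ reds S * 2
    upper = handshake S uniq

    heavy-edge : ∀ {a b} → Covered S p h a b → Heavy S a b
    heavy-edge (link l)              = link-weight l
    heavy-edge (closing _ da db _ _) rewrite da | db = ≤-refl

    lower : h * 2 ≤ weight S xs
    lower = [ (λ eq → weight-even S h H (trans len eq)) , (λ eq → weight-odd S h H (trans len eq)) ]′ parity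
      where H = Linked.map (heavy-edge ∘ covers) L

    contra : reds S < h ⊎ reds S ≡ h → ⊥
    contra (inj₁ R<h) = <-irrefl refl (≤-trans (s≤s (≤-trans lower upper)) (*-monoˡ-< 2 R<h))
    contra (inj₂ R≡h) with alive P
    ... | inj₁ R≡0      = contradiction (≤-trans h≥1 (≤-reflexive (trans (sym R≡h) R≡0))) λ ()
    ... | inj₂ (z , dz) = [ (λ eq → tight-even h K uniq (trans len eq) W on-path dz)
                          , (λ eq → tight-odd h K (trans len eq) W (on-path dz) dz) ]′ parity
      where
      W : weight S xs ≤ h * 2
      W = subst (λ m → weight S xs ≤ m * 2) R≡h upper
      linked : ∀ {a b} → Covered S p h a b → Link S p a b
      linked (link l)              = l
      linked (closing R<h _ _ _ _) = contradiction R<h (<-irrefl R≡h)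
      K : Linked (Link S p) xs
      K = Linked.map (linked ∘ covers) L
      -- A vertex of degree 1 off the path could be added to the handshake count, whose total would
      -- then exceed `h * 2`.
      on-path : ∀ {w} → deg S w ≡ 1 → w ∈ xs
      on-path {w} dw with w ∈? xs
      ... | yes w∈ = w∈
      ... | no w∉  = contradiction
        (≤-trans (s≤s lower) (subst₂ (λ d m → d + weight S xs ≤ m * 2) dw R≡h
          (handshake S (All.tabulate (λ { x∈ refl → w∉ x∈ }) ∷ uniq))))
        (<-irrefl refl)

  -- Degrees and mates depend on the red edges only, so all data carry over.
  blue-move : ∀ {p} → Position S p h → Covered S p h u v → Position ((u , v , blue) ∷ S) p h
  blue-move {S} {u} {v} {p} P C = record
    { mates   = record { deg≤2 = deg≤2 M ; isolated = isolated M ; proper = proper M ; end = end M ; mate = mate M }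
    ; reds≤h  = reds≤h P
    ; alive   = alive P
    ; covered = λ { (here refl) → copy C ; (there e) → copy (covered P e) } }
    where
    M = mates P
    copy : ∀ {a b} → Covered S p h a b → Covered ((u , v , blue) ∷ S) p h a b
    copy (link (inj₁ da))        = link (inj₁ da)
    copy (link (inj₂ (inj₁ db))) = link (inj₂ (inj₁ db))
    copy (link (inj₂ (inj₂ π)))  = link (inj₂ (inj₂ record
      { end₁ = end₁ π ; end₂ = end₂ π ; mate₁ = mate₁ π ; mate₂ = mate₂ π ; another = another π }))
    copy (closing R da db π ρ)   = closing R da db π ρ

  red-move : ∀ {p} → Position S p h → u ≢ v → deg S u ≤ 1 → deg S v ≤ 1 → p u ≢ v → reds S < h →
             Position ((u , v , red) ∷ S) (relink p u v) h
  red-move {S} {u} {v} {p} P u≢v du dv pu≢v R<h = record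
    { mates   = mates-red M u≢v du dv pu≢v
    ; reds≤h  = R<h
    ; alive   = inj₂ (alive-red M u≢v du dv pu≢v)
    ; covered = λ { (there e) → link (update (covered P e)) } }
    where
    M = mates P
    update : ∀ {a b} → Covered S p h a b → Link ((u , v , red) ∷ S) (relink p u v) a b
    update (link (inj₁ da))         = inj₁ (full-red M u≢v du dv pu≢v da)
    update (link (inj₂ (inj₁ db)))  = inj₂ (inj₁ (full-red M u≢v du dv pu≢v db))
    update (link (inj₂ (inj₂ π)))   = pair-red M u≢v du dv pu≢v (end₁ π) (end₂ π) (mate₁ π) (mate₂ π)
    update (closing _ da db π ρ)    = pair-red M u≢v du dv pu≢v da db π ρ

  paint : ∀ {p} → Position S p h → n + length S < ℓ + h → ¬ BuilderWins K13 (Path ℓ) n S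
  paint P lt (done (inj₁ C)) = no-star (deg≤2 (mates P)) C
  paint P lt (done (inj₂ C)) = no-path P C
  paint {S} {p = p} P lt (step {n} u v u≢v _ next) =
    respond (≤2-cases (deg≤2 M u)) (≤2-cases (deg≤2 M v)) (p u ≟ v) (m≤n⇒m<n∨m≡n (reds≤h P))
    where
    M = mates P
    lt′ : n + suc (length S) < ℓ + h
    lt′ = subst (_< ℓ + h) (sym (+-suc n (length S))) lt
    -- This red edge has number `h + 1` and may close a red cycle: from here on only the degree
    -- bound matters.
    give-up : deg S u ≤ 1 → deg S v ≤ 1 → reds S ≡ h → ⊥
    give-up du dv R≡h =
      all-blue {(u , v , red) ∷ S} (deg-red-≤2 S u≢v du dv (deg≤2 M)) (s≤s (≤-reflexive (sym R≡h))) lt′ (next red)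
    respond : deg S u ≡ 2 ⊎ deg S u ≤ 1 → deg S v ≡ 2 ⊎ deg S v ≤ 1 → Dec (p u ≡ v) → reds S < h ⊎ reds S ≡ h → ⊥
    respond (inj₁ du) _         _          _          = paint (blue-move P (link (inj₁ du))) lt′ (next blue)
    respond (inj₂ du) (inj₁ dv) _          _          = paint (blue-move P (link (inj₂ (inj₁ dv)))) lt′ (next blue)
    respond (inj₂ du) (inj₂ dv) _          (inj₂ R≡h) = give-up du dv R≡h
    respond (inj₂ du) (inj₂ dv) (no pu≢v)  (inj₁ R<h) = paint (red-move P u≢v du dv pu≢v R<h) lt′ (next red)
    -- Here `v` is the mate of `u`. An isolated vertex is its own mate, so `u` has degree 1 and red
    -- would close a cycle.
    respond (inj₂ du) (inj₂ dv) (yes refl) (inj₁ R<h) with ≤1-cases du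
    ... | inj₁ d0 = contradiction (sym (isolated M d0)) u≢v
    ... | inj₂ d1 = paint (blue-move P (closing R<h d1 (end M d1) refl (mate M d1))) lt′ (next blue)

  initial : Position [] id h
  initial = record
    { mates   = record { deg≤2 = λ _ → z≤n ; isolated = λ _ → refl ; proper = λ () ; end = λ () ; mate = λ () }
    ; reds≤h  = z≤n
    ; alive   = inj₁ refl
    ; covered = λ () }

  painter : n < ℓ + h → ¬ BuilderWins K13 (Path ℓ) n []
  painter lt = paint initial (subst (_< ℓ + h) (sym (+-identityʳ _)) lt)

-- The value of the online Ramsey number

value : ∀ ℓ → ℓ + ℓ / 2 ≡ (3 * ℓ) / 2
value ℓ = sym (trans (cong (_/ 2) 3ℓ) (trans (+-distrib-/-∣ˡ {ℓ * 2} ℓ (divides-refl ℓ)) (cong (_+ ℓ / 2) (m*n/n≡m ℓ 2))))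
  where
  3ℓ : 3 * ℓ ≡ ℓ * 2 + ℓ
  3ℓ = trans (+-comm ℓ (2 * ℓ)) (cong (_+ ℓ) (*-comm 2 ℓ))

even-or-odd : ∀ ℓ → ℓ ≡ ℓ / 2 * 2 ⊎ ℓ ≡ suc (ℓ / 2 * 2)
even-or-odd ℓ with ℓ % 2 | m≡m%n+[m/n]*n ℓ 2 | m%n<n ℓ 2
... | 0           | eq | _                = inj₁ eq
... | 1           | eq | _                = inj₂ eq
... | suc (suc _) | _  | s≤s (s≤s ())

upper : ∀ ℓ → 2 ≤ ℓ → BuilderWins K13 (Path ℓ) (ℓ + ℓ / 2) []
upper 2 _ = builder₂
upper 3 _ = builder₃
upper (suc (suc (suc (suc m)))) _ = builder m ((4 + m) / 2)
  -- The bound `3 + m ≤ h * 2` is attained for odd `ℓ` and has slack one for even `ℓ`.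
  ([ (λ eq → <⇒≤ (≤-reflexive eq)) , (λ eq → ≤-reflexive (suc-injective eq)) ]′ (even-or-odd (4 + m)))
upper 1 (s≤s ())

theorem1p1 : ∀ (ℓ : ℕ) → 2 ≤ ℓ → OnlineRamseyIs K13 (Path ℓ) ((3 * ℓ) / 2)
theorem1p1 ℓ 2≤ℓ = subst (OnlineRamseyIs K13 (Path ℓ)) (value ℓ)
  (upper ℓ 2≤ℓ , λ _ → Painter.painter ℓ (ℓ / 2) (m≥n⇒m/n>0 2≤ℓ) (even-or-odd ℓ))
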